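{- For every nonempty finite set $X\subset\mathbb{R}^d$, every integer $1\le k\le |X|$, and every noise parameter $0\le\varepsilon<1$, let $C$ be the set of $k$ centers returned by $\varepsilon$-noisy $k$-means++ on input $(X,k,\varepsilon)$. Against every adaptive adversary satisfying the noisy sampling rule, $$\mathbf{E}[\varphi(X,C)]\le 8(\ln k+2)\left(\frac{1+\varepsilon}{1-\varepsilon}\right)^4\mathrm{OPT}_k(X).$$ Moreover, for $0\le\varepsilon<1/2$, the additional multiplicative factor satisfies $\left(\frac{1+\varepsilon}{1-\varepsilon}\right)^4\le 1+160\varepsilon$.
   Context: For finite $X\subset\mathbb{R}^d$ and a nonempty finite set of centers $C\subset\mathbb{R}^d$, $\varphi(X,C)=\sum_{x\in X}\min_{c\in C}\|x-c\|^2$, and $\varphi(x,C):=\varphi(\{x\},C)$. The optimal cost is $\mathrm{OPT}_k(X)=\min_{C\subset\mathbb{R}^d,\,|C|=k}\varphi(X,C)$. $\varepsilon$-noisy $k$-means++ ($n=|X|$): in the first round an adversary chooses a probability distribution $q_1$ on $X$ with $q_1(x)\in[(1-\varepsilon)/n,(1+\varepsilon)/n]$ for every $x\in X$; a point $x\sim q_1$ is sampled and $C_1=\{x\}$. Then, for $j=1,\dots,k-1$, the adversary, who may adapt to the whole history so far, chooses a probability distribution $q_{j+1}$ on $X$ satisfying $$(1-\varepsilon)\frac{\varphi(x,C_j)}{\varphi(X,C_j)}\le q_{j+1}(x)\le(1+\varepsilon)\frac{\varphi(x,C_j)}{\varphi(X,C_j)}\quad\text{for every }x\in X;$$ a point $x\sim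 q_{j+1}$ is sampled and $C_{j+1}=C_j\cup\{x\}$. The output is $C=C_k$. (Since the points of $X$ are distinct and $j<k\le|X|$, $\varphi(X,C_j)>0$ whenever it is used.) These constraints on $q_1,\dots,q_k$ are the noisy sampling rule. -}

module Defs where

open import Algebra.Bundles using (CommutativeRing; Semiring)
import Algebra.Definitions.RawSemiring as RawSemiringDefinitions
import Algebra.Construct.NaturalChoice.Min as Min
import Algebra.Properties.Ring as RingProperties
import Data.Fin.Properties as FinP
open import Data.Fin.Base as Fin using (Fin; inject≤)
import Data.List.Base as List
import Data.List.Properties as List
import Data.List.Relation.Unary.Unique.Setoid as UniqueSetoid
import Data.List.Relation.Unary.Unique.Setoid.Properties as Unique
open import Data.List.NonEmpty.Base as List⁺ using (List⁺; _∷_; _∷⁺_; [_])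
open import Data.Nat.Base as ℕ using (ℕ; zero; suc; pred)
open import Data.Product.Base using (∃; _×_; _,_; proj₁; proj₂)
open import Data.Sum.Base using (inj₁; inj₂)
open import Data.Vec.Functional using (Vector)
import Data.Vec.Functional.Relation.Binary.Equality.Setoid as VectorEquality
open import Function.Definitions using (Injective)
open import Level using (0ℓ)
open import Relation.Binary.Bundles using (TotalOrder; Poset)
open import Relation.Binary.Core using (Rel)
import Relation.Binary.Construct.NonStrictToStrict as NonStrictToStrict
import Relation.Binary.Reasoning.PartialOrder as ≤-Reasoning
open import Relation.Binary.PropositionalEquality.Core as ≡ using (_≡_)
open import Relation.Binary.Structures using (IsDecTotalOrder)
open import Relation.Nullary.Negation using (¬_; contradiction)
open import Relation.Unary using (Pred)

module Bounds {A : Set} (_≤_ : Rel A 0ℓ) where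

  UpperBound LowerBound : Pred A 0ℓ → Pred A 0ℓ
  UpperBound P u = ∀ {x} → P x → x ≤ u
  LowerBound P l = ∀ {x} → P x → l ≤ x

  IsSupremum IsInfimum : Pred A 0ℓ → Pred A 0ℓ
  IsSupremum P s = UpperBound P s × LowerBound (UpperBound P) s
  IsInfimum  P i = LowerBound P i × UpperBound (LowerBound P) i

-- The real numbers, axiomatised classically: a Dedekind-complete ordered
-- field, which is unique up to isomorphism.
record CompleteOrderedField : Set₁ where
  infix  4 _≤_
  infix  9 _⁻¹
  infixl 7 _/_

  field
    commutativeRing : CommutativeRing 0ℓ 0ℓ

  open CommutativeRing commutativeRing public

  field
    0≉1 : ¬ (0# ≈ 1#)

    -- The value of 0# ⁻¹ is left unspecified.
    _⁻¹        : Carrier → Carrier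
    ⁻¹-cong    : ∀ {x y} → x ≈ y → x ⁻¹ ≈ y ⁻¹
    ⁻¹-inverse : ∀ {x} → ¬ (x ≈ 0#) → x ⁻¹ * x ≈ 1#

    _≤_             : Rel Carrier 0ℓ
    isDecTotalOrder : IsDecTotalOrder _≈_ _≤_
    +-monoˡ-≤       : ∀ z {x y} → x ≤ y → x + z ≤ y + z
    *-nonNeg        : ∀ {x y} → 0# ≤ x → 0# ≤ y → 0# ≤ x * y

  open Bounds _≤_ public

  field
    complete : (P : Pred Carrier 0ℓ) → ∃ P → ∃ (UpperBound P) → ∃ (IsSupremum P)

  open NonStrictToStrict _≈_ _≤_ public using (_<_)
  open RawSemiringDefinitions (Semiring.rawSemiring semiring) public using (sum; _^_)
  open RawSemiringDefinitions (Semiring.rawSemiring semiring) using () renaming (_×_ to _·_)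

  _/_ : Carrier → Carrier → Carrier
  x / y = x * y ⁻¹

  fromℕ : ℕ → Carrier
  fromℕ n = n · 1#

  totalOrder : TotalOrder 0ℓ 0ℓ 0ℓ
  totalOrder = record
    { isTotalOrder = IsDecTotalOrder.isTotalOrder isDecTotalOrder }

  open Min totalOrder public using (_⊓_; ⊓-glb)

  infimum : (P : Pred Carrier 0ℓ) → ∃ P → ∃ (LowerBound P) → ∃ (IsInfimum P)
  infimum P (x , Px) (l , l≤P)
    with complete (LowerBound P) (l , l≤P) (x , λ m≤P → m≤P Px)
  ... | i , upper , least = i , (λ Py → least (λ m≤P → m≤P Py)) , upper

module RealProperties (ℝ : CompleteOrderedField) where

  open CompleteOrderedField ℝ
  open RingProperties ring using (-‿distribˡ-*; -‿distribʳ-*; -‿involutive)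
  open TotalOrder totalOrder public using (poset; total)
    renaming (refl to ≤-refl; trans to ≤-trans; antisym to ≤-antisym;
              reflexive to ≤-reflexive)
  open ≤-Reasoning poset

  +-monoʳ-≤ : ∀ z {x y} → x ≤ y → z + x ≤ z + y
  +-monoʳ-≤ z {x} {y} x≤y = begin
    z + x ≈⟨ +-comm z x ⟩
    x + z ≤⟨ +-monoˡ-≤ z x≤y ⟩
    y + z ≈⟨ +-comm y z ⟩
    z + y ∎

  +-mono-≤ : ∀ {x y u v} → x ≤ y → u ≤ v → x + u ≤ y + v
  +-mono-≤ {y = y} {u} x≤y u≤v = ≤-trans (+-monoˡ-≤ u x≤y) (+-monoʳ-≤ y u≤v)

  +-nonNeg : ∀ {x y} → 0# ≤ x → 0# ≤ y → 0# ≤ x + y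
  +-nonNeg 0≤x 0≤y = ≤-trans (≤-reflexive (sym (+-identityˡ 0#))) (+-mono-≤ 0≤x 0≤y)

  telescope : ∀ x y z → (y - x) + (z - y) ≈ z - x
  telescope x y z = begin-equality
    (y - x) + (z - y)   ≈⟨ +-comm (y - x) (z - y) ⟩
    (z - y) + (y - x)   ≈⟨ +-assoc z (- y) (y - x) ⟩
    z + (- y + (y - x)) ≈⟨ +-congˡ (+-assoc (- y) y (- x)) ⟨
    z + (- y + y - x)   ≈⟨ +-congˡ (+-congʳ (-‿inverseˡ y)) ⟩
    z + (0# - x)        ≈⟨ +-congˡ (+-identityˡ (- x)) ⟩
    z - x               ∎

  x≤y⇒0≤y-x : ∀ {x y} → x ≤ y → 0# ≤ y - x
  x≤y⇒0≤y-x {x} {y} x≤y = begin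
    0#    ≈⟨ -‿inverseʳ x ⟨
    x - x ≤⟨ +-monoˡ-≤ (- x) x≤y ⟩
    y - x ∎

  0≤y-x⇒x≤y : ∀ {x y} → 0# ≤ y - x → x ≤ y
  0≤y-x⇒x≤y {x} {y} 0≤y-x = begin
    x             ≈⟨ +-identityˡ x ⟨
    0# + x        ≤⟨ +-monoˡ-≤ x 0≤y-x ⟩
    y - x + x     ≈⟨ +-assoc y (- x) x ⟩
    y + (- x + x) ≈⟨ +-congˡ (-‿inverseˡ x) ⟩
    y + 0#        ≈⟨ +-identityʳ y ⟩
    y             ∎

  *-monoʳ-≤ : ∀ {z x y} → 0# ≤ z → x ≤ y → z * x ≤ z * y
  *-monoʳ-≤ {z} {x} {y} 0≤z x≤y = 0≤y-x⇒x≤y (begin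
    0#              ≤⟨ *-nonNeg 0≤z (x≤y⇒0≤y-x x≤y) ⟩
    z * (y - x)     ≈⟨ distribˡ z y (- x) ⟩
    z * y + z * - x ≈⟨ +-congˡ (-‿distribʳ-* z x) ⟨
    z * y - z * x   ∎)

  x≤0⇒0≤-x : ∀ {x} → x ≤ 0# → 0# ≤ - x
  x≤0⇒0≤-x {x} x≤0 = ≤-trans (x≤y⇒0≤y-x x≤0) (≤-reflexive (+-identityˡ (- x)))

  0≤x*x : ∀ x → 0# ≤ x * x
  0≤x*x x with total 0# x
  ... | inj₁ 0≤x = *-nonNeg 0≤x 0≤x
  ... | inj₂ x≤0 = begin
    0#          ≤⟨ *-nonNeg (x≤0⇒0≤-x x≤0) (x≤0⇒0≤-x x≤0) ⟩
    - x * - x   ≈⟨ -‿distribˡ-* x (- x) ⟨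
    - (x * - x) ≈⟨ -‿cong (-‿distribʳ-* x x) ⟨
    - - (x * x) ≈⟨ -‿involutive (x * x) ⟩
    x * x       ∎

  0≤x² : ∀ x → 0# ≤ x ^ 2
  0≤x² x = ≤-trans (0≤x*x x) (≤-reflexive (*-congˡ (sym (*-identityʳ x))))

  0≤1 : 0# ≤ 1#
  0≤1 = ≤-trans (0≤x*x 1#) (≤-reflexive (*-identityˡ 1#))

  0≤fromℕ : ∀ n → 0# ≤ fromℕ n
  0≤fromℕ zero    = ≤-refl
  0≤fromℕ (suc n) = +-nonNeg 0≤1 (0≤fromℕ n)

  1≤fromℕ : ∀ {n} → 1 ℕ.≤ n → 1# ≤ fromℕ n
  1≤fromℕ {suc n} _ = begin
    1#           ≈⟨ +-identityʳ 1# ⟨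
    1# + 0#      ≤⟨ +-monoʳ-≤ 1# (0≤fromℕ n) ⟩
    1# + fromℕ n ∎

  0≤sum : ∀ {n} (f : Vector Carrier n) → (∀ i → 0# ≤ f i) → 0# ≤ sum f
  0≤sum {zero}  f 0≤f = ≤-refl
  0≤sum {suc n} f 0≤f = +-nonNeg (0≤f Fin.zero) (0≤sum (λ i → f (Fin.suc i)) (λ i → 0≤f (Fin.suc i)))

  1≤x⇒x⁻¹≤1 : ∀ {x} → 1# ≤ x → x ⁻¹ ≤ 1#
  1≤x⇒x⁻¹≤1 {x} 1≤x = begin
    x ⁻¹      ≈⟨ *-identityʳ (x ⁻¹) ⟨
    x ⁻¹ * 1# ≤⟨ *-monoʳ-≤ 0≤x⁻¹ 1≤x ⟩
    x ⁻¹ * x  ≈⟨ ⁻¹-inverse x≉0 ⟩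
    1#        ∎
    where
    0≤x : 0# ≤ x
    0≤x = ≤-trans 0≤1 1≤x

    x≉0 : ¬ (x ≈ 0#)
    x≉0 x≈0 = 0≉1 (≤-antisym 0≤1 (≤-trans 1≤x (≤-reflexive x≈0)))

    0≤x⁻¹ : 0# ≤ x ⁻¹
    0≤x⁻¹ with total 0# (x ⁻¹)
    ... | inj₁ 0≤x⁻¹ = 0≤x⁻¹
    ... | inj₂ x⁻¹≤0 = contradiction (≤-antisym 0≤1 (begin
      1#       ≈⟨ ⁻¹-inverse x≉0 ⟨
      x ⁻¹ * x ≈⟨ *-comm (x ⁻¹) x ⟩
      x * x ⁻¹ ≤⟨ *-monoʳ-≤ 0≤x x⁻¹≤0 ⟩
      x * 0#   ≈⟨ zeroʳ x ⟩
      0#       ∎)) 0≉1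

-- ln x = ∫₁ˣ dt/t for x ≥ 1, as a (lower) Darboux integral.
module Logarithm (ℝ : CompleteOrderedField) where

  open CompleteOrderedField ℝ
  open RealProperties ℝ

  data Partition : Carrier → Carrier → Set where
    end  : ∀ b → Partition b b
    step : ∀ {a t b} → a ≤ t → Partition t b → Partition a b

  -- On [a , t] with a > 0 the infimum of 1/t is attained at the right endpoint.
  lowerSum : ∀ {a b} → Partition a b → Carrier
  lowerSum (end b)              = 0#
  lowerSum (step {a} {t} a≤t p) = (t - a) / t + lowerSum p

  IsLowerSum : Carrier → Pred Carrier 0ℓ
  IsLowerSum x s = ∃ λ (p : Partition 1# x) → s ≈ lowerSum p

  lowerSum≤ : ∀ {a b} → 1# ≤ a → (p : Partition a b) → lowerSum p ≤ b - a
  lowerSum≤ 1≤a (end b) = ≤-reflexive (sym (-‿inverseʳ b))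
  lowerSum≤ {a} {b} 1≤a (step {t = t} a≤t p) = begin
    (t - a) / t + lowerSum p  ≤⟨ +-mono-≤ (*-monoʳ-≤ (x≤y⇒0≤y-x a≤t) (1≤x⇒x⁻¹≤1 1≤t))
                                          (lowerSum≤ 1≤t p) ⟩
    (t - a) * 1# + (b - t)    ≈⟨ +-congʳ (*-identityʳ (t - a)) ⟩
    (t - a) + (b - t)         ≈⟨ telescope a t b ⟩
    b - a                     ∎
    where
    open ≤-Reasoning poset
    1≤t = ≤-trans 1≤a a≤t

  ln-supremum : ∀ x → 1# ≤ x → ∃ (IsSupremum (IsLowerSum x))
  ln-supremum x 1≤x = complete (IsLowerSum x)
    (_ , step 1≤x (end x) , refl)
    (x - 1# , λ { (p , s≈) → ≤-trans (≤-reflexive s≈) (lowerSum≤ ≤-refl p) })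

  ln : ∀ x → 1# ≤ x → Carrier
  ln x 1≤x = proj₁ (ln-supremum x 1≤x)

module KMeans (ℝ : CompleteOrderedField) where

  open CompleteOrderedField ℝ public
  open RealProperties ℝ public using (1≤fromℕ)
  open RealProperties ℝ using (0≤sum; 0≤x²)
  open Logarithm ℝ public using (ln)
  open VectorEquality setoid public using (_≋_)
  open VectorEquality setoid using (≋-setoid)

  Point : ℕ → Set
  Point d = Vector Carrier d

  ‖_-_‖² : ∀ {d} → Point d → Point d → Carrier
  ‖ x - c ‖² = sum (λ i → (x i - c i) ^ 2)

  -- The cost of a single point. Finite nonempty sets of centers are given by
  -- their lists of elements, on whose order and repetitions φ does not depend.
  φ₁ : ∀ {d} → Point d → List⁺ (Point d) → Carrier
  φ₁ x C = List⁺.foldr₁ _⊓_ (List⁺.map (λ c → ‖ x - c ‖²) C)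

  φ : ∀ {n d} → (Fin n → Point d) → List⁺ (Point d) → Carrier
  φ X C = sum (λ i → φ₁ (X i) C)

  HasCardinality : ∀ {d} → List⁺ (Point d) → ℕ → Set
  HasCardinality {d} C k =
    UniqueSetoid.Unique (≋-setoid d) (List⁺.toList C) × List⁺.length C ≡ k

  IsCost : ∀ {n d} → (Fin n → Point d) → ℕ → Pred Carrier 0ℓ
  IsCost X k v = ∃ λ C → HasCardinality C k × v ≈ φ X C

  φ₁-nonNeg : ∀ {d} (x : Point d) C → 0# ≤ φ₁ x C
  φ₁-nonNeg x (c ∷ C) = go c C
    where
    0≤‖‖² : ∀ c → 0# ≤ ‖ x - c ‖²
    0≤‖‖² c = 0≤sum _ (λ i → 0≤x² (x i - c i))

    go : ∀ c C → 0# ≤ φ₁ x (c ∷ C)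
    go c List.[]        = 0≤‖‖² c
    go c (c′ List.∷ C) = ⊓-glb (0≤‖‖² c) (go c′ C)

  φ-nonNeg : ∀ {n d} (X : Fin n → Point d) C → 0# ≤ φ X C
  φ-nonNeg X C = 0≤sum _ (λ i → φ₁-nonNeg (X i) C)

  module _ {n d k} (X : Fin n → Point d) (X-distinct : Injective _≡_ _≋_ X)
           (1≤k : 1 ℕ.≤ k) (k≤n : k ℕ.≤ n) where

    someCost : ∃ (IsCost X k)
    someCost = choose 1≤k k≤n
      where
      choose : ∀ {k} → 1 ℕ.≤ k → k ℕ.≤ n → ∃ (IsCost X k)
      choose {suc m} _ k≤n = φ X C , C , (unique , ≡.cong suc (List.length-tabulate _)) , refl
        where
        f : Fin (suc m) → Point d
        f i = X (inject≤ i k≤n)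

        C : List⁺ (Point d)
        C = f Fin.zero ∷ List.tabulate (λ i → f (Fin.suc i))

        unique : UniqueSetoid.Unique (≋-setoid d) (List⁺.toList C)
        unique = Unique.tabulate⁺ (≋-setoid d) {f = f}
          (λ fi≋fj → FinP.inject≤-injective k≤n k≤n _ _ (X-distinct fi≋fj))

    OPT-infimum : ∃ (IsInfimum (IsCost X k))
    OPT-infimum = infimum (IsCost X k) someCost
      (0# , λ { (C , _ , v≈) → TotalOrder.trans totalOrder (φ-nonNeg X C)
                                 (TotalOrder.reflexive totalOrder (sym v≈)) })

    -- As 1 ≤ k ≤ n, the minimum in OPTₖ(X) is attained, so it is the infimum;
    -- the latter is a total function without an attainment proof.
    OPT : Carrier
    OPT = proj₁ OPT-infimum

  -- A history lists the indices of the points sampled so far, latest first.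
  History : ℕ → Set
  History n = List⁺ (Fin n)

  record Adversary (n : ℕ) : Set where
    field
      first : Fin n → Carrier
      next  : History n → Fin n → Carrier

  open Adversary public

  centers : ∀ {n d} → (Fin n → Point d) → History n → List⁺ (Point d)
  centers X h = List⁺.map X h

  record IsDistribution {n} (q : Fin n → Carrier) : Set where
    field
      nonNeg  : ∀ i → 0# ≤ q i
      sum-one : sum q ≈ 1#

  record NoisyRule {n d} (X : Fin n → Point d) (k : ℕ) (ε : Carrier)
                   (q : Adversary n) : Set where
    field
      first-distribution : IsDistribution (first q)
      first-lower : ∀ i → (1# - ε) / fromℕ n ≤ first q i
      first-upper : ∀ i → first q i ≤ (1# + ε) / fromℕ n

      next-distribution : ∀ h → List⁺.length h ℕ.< k → IsDistribution (next q h)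
      next-lower : ∀ h → List⁺.length h ℕ.< k → ∀ i →
        (1# - ε) * (φ₁ (X i) (centers X h) / φ X (centers X h)) ≤ next q h i
      next-upper : ∀ h → List⁺.length h ℕ.< k → ∀ i →
        next q h i ≤ (1# + ε) * (φ₁ (X i) (centers X h) / φ X (centers X h))

  -- Conditional expectation of f, given the history, after r further rounds.
  𝔼-from : ∀ {n} → Adversary n → ℕ → History n → (History n → Carrier) → Carrier
  𝔼-from q zero    h f = f h
  𝔼-from q (suc r) h f = sum (λ i → next q h i * 𝔼-from q r (i ∷⁺ h) f)

  -- Expectation of f over the histories of k ≥ 1 rounds.
  𝔼 : ∀ {n} → Adversary n → ℕ → (History n → Carrier) → Carrier
  𝔼 q k f = sum (λ i → first q i * 𝔼-from q (pred k) [ i ] f)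

{-# OPTIONS --safe #-}
-- Fix k centers and the clusters they induce. As in the noiseless case, sampling
-- from a not yet hit cluster brings its expected cost down to 8ρ times its
-- optimal cost, ρ = (1 + ε) / (1 - ε), so the cost of the hit clusters stays
-- bounded; what has to be controlled is the average cost of the unhit ones, since
-- every round that hits no new cluster costs one such average.
--
-- Noise can make this average grow in expectation. Instead, for a level θ, call an
-- unhit cluster high if its cost is at least θ and low if ρ times its cost is less
-- than θ. A high cluster is hit at least as likely as a low one despite the noise,
-- so high / (high + low) is a supermartingale, and it decreases when costs do. Its
-- integral G over θ is then one as well. By the layer-cake formula G dominates the
-- average cost, and it is at most ρ times that average because
-- high / (high + low) ≤ (number of unhit clusters of cost ≥ θ / ρ) / (number unhit).
-- With r rounds left and u unhit clusters, (u - r) G bounds the remaining unhit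
-- cost at r = 0, vanishes after the first round, and grows per round by at most
-- ρ² / r times the cost of the hit clusters; the harmonic sum gives ln k.

module Submission where

open import Defs
import Algebra.Construct.NaturalChoice.Min as Min
import Algebra.Properties.AbelianGroup as AbelianGroupProperties
import Algebra.Properties.Ring as RingProperties
import Algebra.Properties.Semiring.Mult as SemiringMult
import Algebra.Properties.Semiring.Sum as SemiringSum
import Algebra.Solver.Ring as RingSolver
open import Algebra.Solver.Ring.AlmostCommutativeRing
open import Data.Bool.Base using (Bool; true; false; _∧_; not)
open import Data.Fin.Base as Fin using (Fin)
import Data.Fin.Properties as Fin
open import Data.Integer.Base as ℤ using (ℤ; -[1+_]; _⊖_) renaming (+_ to pos)
import Data.Integer.Properties as ℤ
open import Data.List.Base as List using (List)
open import Data.List.Membership.Propositional using (_∈_)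
open import Data.List.Membership.Propositional.Properties using (∈-tabulate⁺; ∈-concat⁺′)
open import Data.List.NonEmpty.Base as List⁺ using (_∷_; _∷⁺_; [_])
open import Data.List.Relation.Binary.Permutation.Propositional using (↭-sym)
import Data.List.Relation.Binary.Permutation.Propositional.Properties as Permutation
open import Data.List.Relation.Unary.All as All using (All)
import Data.List.Relation.Unary.All.Properties as All
open import Data.List.Relation.Unary.AllPairs as AllPairs using (AllPairs)
open import Data.List.Relation.Unary.Any using (here; there)
import Data.List.Relation.Unary.Linked.Properties as Linked
import Data.List.Sort as Sort
open import Data.Maybe.Base using (Maybe; just; nothing)
open import Data.Nat.Base as ℕ using (ℕ; zero; suc)
import Data.Nat.Properties as ℕ
open import Data.Product.Base using (_×_; _,_; ∃; proj₁; proj₂)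
open import Data.Sum.Base using (inj₁; inj₂)
import Data.Vec.Functional as Vector
open import Function.Definitions using (Injective)
open import Level using (0ℓ)
open import Relation.Binary.Bundles using (DecTotalOrder)
open import Relation.Binary.PropositionalEquality.Core as ≡ using (_≡_)
import Relation.Binary.Reasoning.PartialOrder as ≤-Reasoning
open import Relation.Nullary using (Dec; yes; no; does; contradiction)

module Development (ℝ : CompleteOrderedField) where

  open KMeans ℝ hiding (zero)
  open RealProperties ℝ hiding (1≤fromℕ)
  open Logarithm ℝ hiding (ln)
  open ≤-Reasoning poset

  decTotalOrder : DecTotalOrder 0ℓ 0ℓ 0ℓ
  decTotalOrder = record { isDecTotalOrder = isDecTotalOrder }

  open DecTotalOrder decTotalOrder using (_≤?_) renaming (_≟_ to _≈?_)

  -- A ring solver with integer coefficients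

  open RingProperties ring
    using (-‿distribˡ-*; -‿distribʳ-*; -‿involutive; -0#≈0#)
  open AbelianGroupProperties +-abelianGroup using (⁻¹-∙-comm)
  open SemiringMult semiring using (×-homo-+; ×1-homo-*)

  -- fromℕ 1 is 1# + 0#; the special case lets the solver's constant 1 denote 1# itself.
  embedℕ : ℕ → Carrier
  embedℕ 1 = 1#
  embedℕ n = fromℕ n

  embed : ℤ → Carrier
  embed (pos n)  = embedℕ n
  embed -[1+ n ] = - embedℕ (suc n)

  embedℕ≈fromℕ : ∀ n → embedℕ n ≈ fromℕ n
  embedℕ≈fromℕ zero          = refl
  embedℕ≈fromℕ (suc zero)    = sym (+-identityʳ 1#)
  embedℕ≈fromℕ (suc (suc n)) = refl

  cancel-suc : ∀ x y → (1# + x) - (1# + y) ≈ x - y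
  cancel-suc x y = begin-equality
    (1# + x) - (1# + y)     ≈⟨ +-cong (+-comm 1# x) (sym (⁻¹-∙-comm 1# y)) ⟩
    (x + 1#) + (- 1# - y)   ≈⟨ +-assoc x 1# _ ⟩
    x + (1# + (- 1# - y))   ≈⟨ +-congˡ (+-assoc 1# (- 1#) (- y)) ⟨
    x + (1# - 1# - y)       ≈⟨ +-congˡ (+-congʳ (-‿inverseʳ 1#)) ⟩
    x + (0# - y)            ≈⟨ +-congˡ (+-identityˡ (- y)) ⟩
    x - y                   ∎

  embed-⊖ : ∀ m n → embed (m ⊖ n) ≈ fromℕ m - fromℕ n
  embed-⊖ m zero = begin-equality
    embedℕ m     ≈⟨ embedℕ≈fromℕ m ⟩
    fromℕ m      ≈⟨ +-identityʳ (fromℕ m) ⟨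
    fromℕ m + 0# ≈⟨ +-congˡ -0#≈0# ⟨
    fromℕ m - 0# ∎
  embed-⊖ zero (suc n) = begin-equality
    - embedℕ (suc n)     ≈⟨ -‿cong (embedℕ≈fromℕ (suc n)) ⟩
    - fromℕ (suc n)      ≈⟨ +-identityˡ _ ⟨
    0# - fromℕ (suc n)   ∎
  embed-⊖ (suc m) (suc n) = begin-equality
    embed (suc m ⊖ suc n)     ≡⟨ ≡.cong embed (ℤ.[1+m]⊖[1+n]≡m⊖n m n) ⟩
    embed (m ⊖ n)             ≈⟨ embed-⊖ m n ⟩
    fromℕ m - fromℕ n         ≈⟨ cancel-suc (fromℕ m) (fromℕ n) ⟨
    fromℕ (suc m) - fromℕ (suc n) ∎

  embed-neg : ∀ x → embed (ℤ.- x) ≈ - embed x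
  embed-neg (pos zero)    = sym -0#≈0#
  embed-neg (pos (suc n)) = refl
  embed-neg -[1+ n ]      = sym (-‿involutive _)

  embed-+ : ∀ x y → embed (x ℤ.+ y) ≈ embed x + embed y
  embed-+ (pos m) (pos n) = begin-equality
    embedℕ (m ℕ.+ n)    ≈⟨ embedℕ≈fromℕ (m ℕ.+ n) ⟩
    fromℕ (m ℕ.+ n)     ≈⟨ ×-homo-+ 1# m n ⟩
    fromℕ m + fromℕ n   ≈⟨ +-cong (embedℕ≈fromℕ m) (embedℕ≈fromℕ n) ⟨
    embedℕ m + embedℕ n ∎
  embed-+ (pos m) -[1+ n ] = trans (embed-⊖ m (suc n))
    (+-cong (sym (embedℕ≈fromℕ m)) (-‿cong (sym (embedℕ≈fromℕ (suc n)))))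
  embed-+ -[1+ m ] (pos n) = trans (embed-⊖ n (suc m)) (trans
    (+-cong (sym (embedℕ≈fromℕ n)) (-‿cong (sym (embedℕ≈fromℕ (suc m)))))
    (+-comm _ _))
  embed-+ -[1+ m ] -[1+ n ] = begin-equality
    - embedℕ (suc (suc (m ℕ.+ n)))        ≡⟨ ≡.cong (λ l → - embedℕ (suc l)) (ℕ.+-suc m n) ⟨
    - embedℕ (suc m ℕ.+ suc n)            ≈⟨ -‿cong (embed-+ (pos (suc m)) (pos (suc n))) ⟩
    - (embedℕ (suc m) + embedℕ (suc n))   ≈⟨ ⁻¹-∙-comm _ _ ⟨
    - embedℕ (suc m) - embedℕ (suc n)     ∎

  embed-*-pos : ∀ m n → embed (pos m ℤ.* pos n) ≈ embedℕ m * embedℕ n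
  embed-*-pos m n = begin-equality
    embed (pos m ℤ.* pos n)   ≡⟨ ≡.cong embed (ℤ.pos-* m n) ⟨
    embedℕ (m ℕ.* n)          ≈⟨ embedℕ≈fromℕ (m ℕ.* n) ⟩
    fromℕ (m ℕ.* n)           ≈⟨ ×1-homo-* m n ⟩
    fromℕ m * fromℕ n         ≈⟨ *-cong (embedℕ≈fromℕ m) (embedℕ≈fromℕ n) ⟨
    embedℕ m * embedℕ n       ∎

  embed-*ˡ : ∀ m y → embed (pos m ℤ.* y) ≈ embedℕ m * embed y
  embed-*ˡ m (pos n)  = embed-*-pos m n
  embed-*ˡ m -[1+ n ] = begin-equality
    embed (pos m ℤ.* -[1+ n ])         ≡⟨ ≡.cong embed (ℤ.neg-distribʳ-* (pos m) (pos (suc n))) ⟨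
    embed (ℤ.- (pos m ℤ.* pos (suc n)))  ≈⟨ embed-neg (pos m ℤ.* pos (suc n)) ⟩
    - embed (pos m ℤ.* pos (suc n))      ≈⟨ -‿cong (embed-*-pos m (suc n)) ⟩
    - (embedℕ m * embedℕ (suc n))        ≈⟨ -‿distribʳ-* _ _ ⟩
    embedℕ m * - embedℕ (suc n)          ∎

  embed-* : ∀ x y → embed (x ℤ.* y) ≈ embed x * embed y
  embed-* (pos m)  y = embed-*ˡ m y
  embed-* -[1+ m ] y = begin-equality
    embed (-[1+ m ] ℤ.* y)             ≡⟨ ≡.cong embed (ℤ.neg-distribˡ-* (pos (suc m)) y) ⟨
    embed (ℤ.- (pos (suc m) ℤ.* y))    ≈⟨ embed-neg (pos (suc m) ℤ.* y) ⟩
    - embed (pos (suc m) ℤ.* y)        ≈⟨ -‿cong (embed-*ˡ (suc m) y) ⟩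
    - (embedℕ (suc m) * embed y)       ≈⟨ -‿distribˡ-* _ _ ⟩
    - embedℕ (suc m) * embed y         ∎

  morphism : ℤ.+-*-rawRing -Raw-AlmostCommutative⟶ fromCommutativeRing commutativeRing
  morphism = record
    { ⟦_⟧    = embed
    ; +-homo = embed-+
    ; *-homo = embed-*
    ; -‿homo = embed-neg
    ; 0-homo = refl
    ; 1-homo = refl
    }

  embed-≟ : ∀ x y → Maybe (embed x ≈ embed y)
  embed-≟ x y with x ℤ.≟ y
  ... | yes x≡y = just (reflexive (≡.cong embed x≡y))
  ... | no _    = nothing

  open RingSolver ℤ.+-*-rawRing (fromCommutativeRing commutativeRing) morphism embed-≟
    using (solve; _:+_; _:*_; _:-_; :-_; _:^_; _:=_; con)

  -- Order and division in the ordered field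

  0<1 : 0# < 1#
  0<1 = 0≤1 , 0≉1

  ≤-slack : ∀ {x y e} → 0# ≤ e → y ≈ x + e → x ≤ y
  ≤-slack {x} {y} {e} 0≤e y≈x+e = begin
    x      ≈⟨ +-identityʳ x ⟨
    x + 0# ≤⟨ +-monoʳ-≤ x 0≤e ⟩
    x + e  ≈⟨ y≈x+e ⟨
    y      ∎

  *-monoˡ-≤ : ∀ {z x y} → 0# ≤ z → x ≤ y → x * z ≤ y * z
  *-monoˡ-≤ {z} {x} {y} 0≤z x≤y = begin
    x * z ≈⟨ *-comm x z ⟩
    z * x ≤⟨ *-monoʳ-≤ 0≤z x≤y ⟩
    z * y ≈⟨ *-comm z y ⟩
    y * z ∎

  *-mono-≤ : ∀ {x y u v} → 0# ≤ u → 0# ≤ y → x ≤ y → u ≤ v → x * u ≤ y * v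
  *-mono-≤ 0≤u 0≤y x≤y u≤v = ≤-trans (*-monoˡ-≤ 0≤u x≤y) (*-monoʳ-≤ 0≤y u≤v)

  <-≤-trans : ∀ {x y} → 0# < x → x ≤ y → 0# < y
  <-≤-trans (0≤x , 0≉x) x≤y = ≤-trans 0≤x x≤y ,
    λ 0≈y → 0≉x (≤-antisym 0≤x (≤-trans x≤y (≤-reflexive (sym 0≈y))))

  ⁻¹-inverseʳ : ∀ {x} → 0# < x → x * x ⁻¹ ≈ 1#
  ⁻¹-inverseʳ {x} (_ , 0≉x) = trans (*-comm x (x ⁻¹)) (⁻¹-inverse (λ x≈0 → 0≉x (sym x≈0)))

  ⁻¹-pos : ∀ {x} → 0# < x → 0# < x ⁻¹
  ⁻¹-pos {x} 0<x@(0≤x , _) = 0≤x⁻¹ , λ 0≈x⁻¹ → 0≉1 (begin-equality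
      0#       ≈⟨ zeroʳ x ⟨
      x * 0#   ≈⟨ *-congˡ 0≈x⁻¹ ⟩
      x * x ⁻¹ ≈⟨ ⁻¹-inverseʳ 0<x ⟩
      1#       ∎)
    where
    0≤x⁻¹ : 0# ≤ x ⁻¹
    0≤x⁻¹ with total 0# (x ⁻¹)
    ... | inj₁ 0≤x⁻¹ = 0≤x⁻¹
    ... | inj₂ x⁻¹≤0 = contradiction (≤-antisym 0≤1 (begin
      1#       ≈⟨ ⁻¹-inverseʳ 0<x ⟨
      x * x ⁻¹ ≤⟨ *-monoʳ-≤ 0≤x x⁻¹≤0 ⟩
      x * 0#   ≈⟨ zeroʳ x ⟩
      0#       ∎)) 0≉1

  *-cancelˡ-≤ : ∀ {z x y} → 0# < z → z * x ≤ z * y → x ≤ y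
  *-cancelˡ-≤ {z} {x} {y} 0<z zx≤zy = begin
    x                ≈⟨ undo x ⟨
    z ⁻¹ * (z * x)   ≤⟨ *-monoʳ-≤ (proj₁ (⁻¹-pos 0<z)) zx≤zy ⟩
    z ⁻¹ * (z * y)   ≈⟨ undo y ⟩
    y                ∎
    where
    undo : ∀ w → z ⁻¹ * (z * w) ≈ w
    undo w = begin-equality
      z ⁻¹ * (z * w) ≈⟨ *-assoc _ _ _ ⟨
      z ⁻¹ * z * w   ≈⟨ *-congʳ (trans (*-comm _ _) (⁻¹-inverseʳ 0<z)) ⟩
      1# * w         ≈⟨ *-identityˡ w ⟩
      w              ∎

  x*y/y≈x : ∀ x {y} → 0# < y → x / y * y ≈ x
  x*y/y≈x x {y} 0<y = begin-equality
    x * y ⁻¹ * y   ≈⟨ *-assoc _ _ _ ⟩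
    x * (y ⁻¹ * y) ≈⟨ *-congˡ (trans (*-comm _ _) (⁻¹-inverseʳ 0<y)) ⟩
    x * 1#         ≈⟨ *-identityʳ x ⟩
    x              ∎

  x*z≤y⇒x≤y/z : ∀ {x y z} → 0# < z → x * z ≤ y → x ≤ y / z
  x*z≤y⇒x≤y/z {x} {y} {z} 0<z xz≤y = *-cancelˡ-≤ 0<z (begin
    z * x       ≈⟨ *-comm z x ⟩
    x * z       ≤⟨ xz≤y ⟩
    y           ≈⟨ x*y/y≈x y 0<z ⟨
    y / z * z   ≈⟨ *-comm _ z ⟩
    z * (y / z) ∎)

  x≤y*z⇒x/z≤y : ∀ {x y z} → 0# < z → x ≤ y * z → x / z ≤ y
  x≤y*z⇒x/z≤y {x} {y} {z} 0<z x≤yz = *-cancelˡ-≤ 0<z (begin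
    z * (x / z) ≈⟨ *-comm z _ ⟩
    x / z * z   ≈⟨ x*y/y≈x x 0<z ⟩
    x           ≤⟨ x≤yz ⟩
    y * z       ≈⟨ *-comm y z ⟩
    z * y       ∎)

  -- Finite sums

  open SemiringSum semiring using (*-distribˡ-sum; sum-replicate-zero)
    renaming (sum-cong-≋ to sum-cong; ∑-distrib-+ to sum-+; ∑-comm to sum-swap)

  *-sum : ∀ {n} x (f : Fin n → Carrier) → sum (λ i → x * f i) ≈ x * sum f
  *-sum x f = sym (*-distribˡ-sum x f)

  sum-0 : ∀ {n} {f : Fin n → Carrier} → (∀ i → f i ≈ 0#) → sum f ≈ 0#
  sum-0 {n} f≈0 = trans (sum-cong f≈0) (sum-replicate-zero n)

  sum-mono : ∀ {n} {f g : Fin n → Carrier} → (∀ i → f i ≤ g i) → sum f ≤ sum g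
  sum-mono {zero}  f≤g = ≤-refl
  sum-mono {suc n} f≤g = +-mono-≤ (f≤g Fin.zero) (sum-mono (λ i → f≤g (Fin.suc i)))

  term≤sum : ∀ {n} (f : Fin n → Carrier) → (∀ i → 0# ≤ f i) → ∀ i → f i ≤ sum f
  term≤sum f 0≤f Fin.zero    = ≤-slack (0≤sum _ (λ i → 0≤f (Fin.suc i))) refl
  term≤sum f 0≤f (Fin.suc i) = ≤-trans (term≤sum _ (λ i → 0≤f (Fin.suc i)) i)
    (≤-slack (0≤f Fin.zero) (+-comm _ _))

  sum≈0⇒≈0 : ∀ {n} {f : Fin n → Carrier} → (∀ i → 0# ≤ f i) → sum f ≈ 0# → ∀ i → f i ≈ 0#
  sum≈0⇒≈0 0≤f sum≈0 i =
    ≤-antisym (≤-trans (term≤sum _ 0≤f i) (≤-reflexive sum≈0)) (0≤f i)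

  sum-linear : ∀ {n} x y (f g : Fin n → Carrier) →
               sum (λ i → x * f i + y * g i) ≈ x * sum f + y * sum g
  sum-linear {n} x y f g = trans (sum-+ {n} _ _) (+-cong (*-sum {n} x f) (*-sum {n} y g))

  -- Sampling inside a cluster

  pairwise-1d : ∀ {n} (e b : Fin n → Carrier) → (∀ i → 0# ≤ e i) →
    sum (λ i → e i * sum (λ a → e a * (b a - b i) ^ 2))
      ≤ fromℕ 2 * (sum e * sum (λ a → e a * b a ^ 2))
  pairwise-1d {n} e b 0≤e = ≤-slack (*-nonNeg (0≤fromℕ 2) (0≤x² E₁)) (begin-equality
      fromℕ 2 * (E₀ * E₂)
        ≈⟨ solve 3 (λ E₀ E₁ E₂ → con (pos 2) :* (E₀ :* E₂)
             := (E₂ :* E₀ :+ :- con (pos 2) :* E₁ :* E₁ :+ E₀ :* E₂) :+ con (pos 2) :* E₁ :^ 2)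
             refl E₀ E₁ E₂ ⟩
      (E₂ * E₀ + - fromℕ 2 * E₁ * E₁ + E₀ * E₂) + fromℕ 2 * E₁ ^ 2
        ≈⟨ +-congʳ outer ⟨
      sum (λ i → e i * sum (λ a → e a * (b a - b i) ^ 2)) + fromℕ 2 * E₁ ^ 2 ∎)
    where
    E₀ = sum e
    E₁ = sum (λ a → e a * b a)
    E₂ = sum (λ a → e a * b a ^ 2)

    inner : ∀ i → sum (λ a → e a * (b a - b i) ^ 2) ≈ E₂ + - fromℕ 2 * b i * E₁ + b i ^ 2 * E₀
    inner i = begin-equality
      sum (λ a → e a * (b a - b i) ^ 2)
        ≈⟨ sum-cong (λ a → solve 3 (λ e x y → e :* (x :- y) :^ 2
             := (e :* x :^ 2 :+ (:- con (pos 2) :* y) :* (e :* x)) :+ y :^ 2 :* e) refl (e a) (b a) (b i)) ⟩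
      sum (λ a → (e a * b a ^ 2 + - fromℕ 2 * b i * (e a * b a)) + b i ^ 2 * e a)
        ≈⟨ trans (sum-+ {n} _ _) (+-cong (trans (sum-+ {n} _ _) (+-congˡ (*-sum {n} _ _))) (*-sum {n} _ _)) ⟩
      E₂ + - fromℕ 2 * b i * E₁ + b i ^ 2 * E₀ ∎

    outer : sum (λ i → e i * sum (λ a → e a * (b a - b i) ^ 2))
              ≈ E₂ * E₀ + - fromℕ 2 * E₁ * E₁ + E₀ * E₂
    outer = begin-equality
      sum (λ i → e i * sum (λ a → e a * (b a - b i) ^ 2))
        ≈⟨ sum-cong (λ i → trans (*-congˡ (inner i)) (solve 5 (λ e y E₀ E₁ E₂ →
             e :* (E₂ :+ :- con (pos 2) :* y :* E₁ :+ y :^ 2 :* E₀)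
             := E₂ :* e :+ :- con (pos 2) :* E₁ :* (e :* y) :+ E₀ :* (e :* y :^ 2))
             refl (e i) (b i) E₀ E₁ E₂)) ⟩
      sum (λ i → E₂ * e i + - fromℕ 2 * E₁ * (e i * b i) + E₀ * (e i * b i ^ 2))
        ≈⟨ trans (sum-+ {n} _ _) (+-cong (trans (sum-+ {n} _ _) (+-cong (*-sum {n} _ _) (*-sum {n} _ _))) (*-sum {n} _ _)) ⟩
      E₂ * E₀ + - fromℕ 2 * E₁ * E₁ + E₀ * E₂ ∎

  -- D i is the current cost of point i, o i its cost for the reference center, s a i
  -- a squared distance, and M a i the cost of a once i has become a center.
  D²-sampling : ∀ {n} (e D o : Fin n → Carrier) (s M : Fin n → Fin n → Carrier) →
    (∀ i → 0# ≤ e i) → (∀ i → 0# ≤ D i) → (∀ i → 0# ≤ o i) → (∀ a i → 0# ≤ s a i) →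
    (∀ a i → 0# ≤ M a i) →
    (∀ a i → D i ≤ fromℕ 2 * (D a + s a i)) →
    (∀ a i → M a i ≤ D a) → (∀ a i → M a i ≤ s a i) →
    sum (λ i → e i * sum (λ a → e a * s a i)) ≤ fromℕ 2 * (sum e * sum (λ a → e a * o a)) →
    sum (λ i → e i * (D i * sum (λ a → e a * M a i)))
      ≤ fromℕ 8 * (sum (λ i → e i * D i) * sum (λ a → e a * o a))
  D²-sampling {n} e D o s M 0≤e 0≤D 0≤o 0≤s 0≤M D≤ M≤D M≤s pairwise
    with 0# ≈? sum e
  ... | yes 0≈m = ≤-trans (≤-reflexive (sum-0 (λ i → trans (*-congʳ (sum≈0⇒≈0 0≤e (sym 0≈m) i)) (zeroˡ _))))
    (*-nonNeg (0≤fromℕ 8) (*-nonNeg (0≤sum _ (λ i → *-nonNeg (0≤e i) (0≤D i)))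
                                    (0≤sum _ (λ i → *-nonNeg (0≤e i) (0≤o i)))))
  -- Multiplying by the total weight `m` avoids forming averages over the cluster.
  ... | no 0≉m = *-cancelˡ-≤ (0≤sum _ 0≤e , 0≉m) (begin
      m * sum (λ i → e i * (D i * Mᵢ i))
        ≈⟨ *-sum {n} m _ ⟨
      sum (λ i → m * (e i * (D i * Mᵢ i)))
        ≤⟨ sum-mono pointwise ⟩
      sum (λ i → fromℕ 4 * A * (e i * sᵢ i))
        ≈⟨ *-sum {n} _ _ ⟩
      fromℕ 4 * A * sum (λ i → e i * sᵢ i)
        ≤⟨ *-monoʳ-≤ (*-nonNeg (0≤fromℕ 4) 0≤A) pairwise ⟩
      fromℕ 4 * A * (fromℕ 2 * (m * V))
        ≈⟨ solve 3 (λ m A V → con (pos 4) :* A :* (con (pos 2) :* (m :* V))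
             := m :* (con (pos 8) :* (A :* V))) refl m A V ⟩
      m * (fromℕ 8 * (A * V)) ∎)
    where
    m = sum e
    A = sum (λ i → e i * D i)
    V = sum (λ a → e a * o a)
    Mᵢ : Fin n → Carrier
    Mᵢ i = sum (λ a → e a * M a i)
    sᵢ : Fin n → Carrier
    sᵢ i = sum (λ a → e a * s a i)

    0≤A : 0# ≤ A
    0≤A = 0≤sum _ (λ i → *-nonNeg (0≤e i) (0≤D i))

    averaged : ∀ i → m * D i ≤ fromℕ 2 * (A + sᵢ i)
    averaged i = begin
      m * D i                                      ≈⟨ *-comm m (D i) ⟩
      D i * m                                      ≈⟨ *-sum (D i) e ⟨
      sum (λ a → D i * e a)                        ≤⟨ sum-mono (λ a → *-monoˡ-≤ (0≤e a) (D≤ a i)) ⟩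
      sum (λ a → fromℕ 2 * (D a + s a i) * e a)    ≈⟨ sum-cong (λ a → solve 3 (λ D s e →
                                                       con (pos 2) :* (D :+ s) :* e := con (pos 2) :* (e :* D :+ e :* s))
                                                       refl (D a) (s a i) (e a)) ⟩
      sum (λ a → fromℕ 2 * (e a * D a + e a * s a i)) ≈⟨ trans (*-sum {n} _ _) (*-congˡ (sum-+ {n} _ _)) ⟩
      fromℕ 2 * (A + sᵢ i) ∎

    -- `Mᵢ` is bounded by `sᵢ` where it multiplies `A`, and by `A` where it multiplies `sᵢ`. Each
    -- summand becomes 2 A sᵢ, which makes 4, and the pairwise bound doubles this to 8.
    pointwise : ∀ i → m * (e i * (D i * Mᵢ i)) ≤ fromℕ 4 * A * (e i * sᵢ i)
    pointwise i = begin
      m * (e i * (D i * Mᵢ i))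
        ≈⟨ solve 4 (λ m e D M → m :* (e :* (D :* M)) := e :* ((m :* D) :* M)) refl m (e i) (D i) (Mᵢ i) ⟩
      e i * (m * D i * Mᵢ i)
        ≤⟨ *-monoʳ-≤ (0≤e i) (*-monoˡ-≤ (0≤sum _ (λ a → *-nonNeg (0≤e a) (0≤M a i))) (averaged i)) ⟩
      e i * (fromℕ 2 * (A + sᵢ i) * Mᵢ i)
        ≈⟨ solve 4 (λ e A s M → e :* (con (pos 2) :* (A :+ s) :* M)
             := con (pos 2) :* (e :* (A :* M)) :+ con (pos 2) :* (e :* (s :* M))) refl (e i) A (sᵢ i) (Mᵢ i) ⟩
      fromℕ 2 * (e i * (A * Mᵢ i)) + fromℕ 2 * (e i * (sᵢ i * Mᵢ i))
        ≤⟨ +-mono-≤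
             (*-monoʳ-≤ (0≤fromℕ 2) (*-monoʳ-≤ (0≤e i) (*-monoʳ-≤ 0≤A
               (sum-mono (λ a → *-monoʳ-≤ (0≤e a) (M≤s a i))))))
             (*-monoʳ-≤ (0≤fromℕ 2) (*-monoʳ-≤ (0≤e i) (*-monoʳ-≤
               (0≤sum _ (λ a → *-nonNeg (0≤e a) (0≤s a i)))
               (sum-mono (λ a → *-monoʳ-≤ (0≤e a) (M≤D a i)))))) ⟩
      fromℕ 2 * (e i * (A * sᵢ i)) + fromℕ 2 * (e i * (sᵢ i * A))
        ≈⟨ solve 3 (λ e A s → con (pos 2) :* (e :* (A :* s)) :+ con (pos 2) :* (e :* (s :* A))
             := con (pos 4) :* A :* (e :* s)) refl (e i) A (sᵢ i) ⟩
      fromℕ 4 * A * (e i * sᵢ i) ∎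

  -- The upper bound on `q` costs a factor ρ on the left, and the lower bound turns α times the mass
  -- of the cluster into at most its hitting probability. The conclusion is a conditional
  -- expectation multiplied by that probability, so clusters of probability zero need no separate
  -- treatment.
  noisy-D²-sampling : ∀ {n} (e D q M : Fin n → Carrier) {α ρ V c : Carrier} →
    0# ≤ α → 0# ≤ ρ → 0# ≤ c → 0# ≤ V →
    (∀ i → 0# ≤ e i) → (∀ i → 0# ≤ M i) →
    (∀ i → α * D i ≤ q i) → (∀ i → q i ≤ ρ * (α * D i)) →
    sum (λ i → e i * (D i * M i)) ≤ c * (sum (λ i → e i * D i) * V) →
    sum (λ i → e i * (q i * M i)) ≤ c * ρ * V * sum (λ i → e i * q i)
  noisy-D²-sampling {n} e D q M {α} {ρ} {V} {c} 0≤α 0≤ρ 0≤c 0≤V 0≤e 0≤M αD≤q q≤ραD exact = begin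
    sum (λ i → e i * (q i * M i))
      ≤⟨ sum-mono (λ i → *-monoʳ-≤ (0≤e i) (*-monoˡ-≤ (0≤M i) (q≤ραD i))) ⟩
    sum (λ i → e i * (ρ * (α * D i) * M i))
      ≈⟨ sum-cong (λ i → solve 5 (λ e ρ α D M → e :* (ρ :* (α :* D) :* M) := ρ :* α :* (e :* (D :* M)))
           refl (e i) ρ α (D i) (M i)) ⟩
    sum (λ i → ρ * α * (e i * (D i * M i)))
      ≈⟨ *-sum {n} _ _ ⟩
    ρ * α * sum (λ i → e i * (D i * M i))
      ≤⟨ *-monoʳ-≤ (*-nonNeg 0≤ρ 0≤α) exact ⟩
    ρ * α * (c * (sum (λ i → e i * D i) * V))
      ≈⟨ solve 5 (λ ρ α c S V → ρ :* α :* (c :* (S :* V)) := c :* ρ :* V :* (α :* S)) refl ρ α c _ V ⟩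
    c * ρ * V * (α * sum (λ i → e i * D i))
      ≈⟨ *-congˡ (*-sum {n} _ _) ⟨
    c * ρ * V * sum (λ i → α * (e i * D i))
      ≈⟨ *-congˡ (sum-cong (λ i → solve 3 (λ α e D → α :* (e :* D) := e :* (α :* D)) refl α (e i) (D i))) ⟩
    c * ρ * V * sum (λ i → e i * (α * D i))
      ≤⟨ *-monoʳ-≤ (*-nonNeg (*-nonNeg 0≤c 0≤ρ) 0≤V) (sum-mono (λ i → *-monoʳ-≤ (0≤e i) (αD≤q i))) ⟩
    c * ρ * V * sum (λ i → e i * q i) ∎

  -- Indicators and sums over fibres

  𝟙 : Bool → Carrier
  𝟙 true  = 1#
  𝟙 false = 0#

  infix 5 _≤ᵇ_ _==_
  _≤ᵇ_ : Carrier → Carrier → Bool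
  x ≤ᵇ y = does (x ≤? y)

  _==_ : ∀ {k} → Fin k → Fin k → Bool
  i == j = does (i Fin.≟ j)

  0≤𝟙 : ∀ b → 0# ≤ 𝟙 b
  0≤𝟙 true  = 0≤1
  0≤𝟙 false = ≤-refl

  𝟙≤1 : ∀ b → 𝟙 b ≤ 1#
  𝟙≤1 true  = ≤-refl
  𝟙≤1 false = 0≤1

  𝟙-∧ : ∀ a b → 𝟙 (a ∧ b) ≈ 𝟙 a * 𝟙 b
  𝟙-∧ true  b = sym (*-identityˡ _)
  𝟙-∧ false b = sym (zeroˡ _)

  𝟙-not : ∀ a → 𝟙 a + 𝟙 (not a) ≈ 1#
  𝟙-not true  = +-identityʳ 1#
  𝟙-not false = +-identityˡ 1#

  𝟙-≤ᵇ-mono : ∀ {x y z} → y ≤ z → 𝟙 (x ≤ᵇ y) ≤ 𝟙 (x ≤ᵇ z)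
  𝟙-≤ᵇ-mono {x} {y} {z} y≤z with x ≤? y | x ≤? z
  ... | yes _   | yes _   = ≤-refl
  ... | yes x≤y | no x≰z  = contradiction (≤-trans x≤y y≤z) x≰z
  ... | no _    | yes _   = 0≤1
  ... | no _    | no _    = ≤-refl

  𝟙-≰ᵇ-mono : ∀ {x y z} → y ≤ z → 𝟙 (not (x ≤ᵇ z)) ≤ 𝟙 (not (x ≤ᵇ y))
  𝟙-≰ᵇ-mono {x} {y} {z} y≤z with x ≤? y | x ≤? z
  ... | yes _   | yes _   = ≤-refl
  ... | yes x≤y | no x≰z  = contradiction (≤-trans x≤y y≤z) x≰z
  ... | no _    | yes _   = 0≤1
  ... | no _    | no _    = ≤-refl

  𝟙-≤ᵇ-* : ∀ x y → 𝟙 (x ≤ᵇ y) * x ≤ 𝟙 (x ≤ᵇ y) * y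
  𝟙-≤ᵇ-* x y with x ≤? y
  ... | yes x≤y = *-monoʳ-≤ 0≤1 x≤y
  ... | no _    = ≤-reflexive (trans (zeroˡ x) (sym (zeroˡ y)))

  𝟙-≰ᵇ-* : ∀ x y → 𝟙 (not (x ≤ᵇ y)) * y ≤ 𝟙 (not (x ≤ᵇ y)) * x
  𝟙-≰ᵇ-* x y with x ≤? y | total x y
  ... | yes _  | _        = ≤-reflexive (trans (zeroˡ y) (sym (zeroˡ x)))
  ... | no _   | inj₂ y≤x = *-monoʳ-≤ 0≤1 y≤x
  ... | no x≰y | inj₁ x≤y = contradiction x≤y x≰y

  sum-pick : ∀ {k} (i : Fin k) (f : Fin k → Carrier) → sum (λ j → 𝟙 (i == j) * f j) ≈ f i
  sum-pick {suc k} Fin.zero f = begin-equality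
    1# * f Fin.zero + sum {k} (λ j → 0# * f (Fin.suc j))
      ≈⟨ +-cong (*-identityˡ _) (sum-0 {k} (λ j → zeroˡ (f (Fin.suc j)))) ⟩
    f Fin.zero + 0#   ≈⟨ +-identityʳ _ ⟩
    f Fin.zero        ∎
  sum-pick {suc k} (Fin.suc i) f = begin-equality
    0# * f Fin.zero + sum {k} (λ j → 𝟙 (i == j) * f (Fin.suc j))
      ≈⟨ +-cong (zeroˡ _) (sum-pick i (λ j → f (Fin.suc j))) ⟩
    0# + f (Fin.suc i) ≈⟨ +-identityˡ _ ⟩
    f (Fin.suc i)      ∎

  fibre : ∀ {n k} → (Fin n → Fin k) → (Fin n → Carrier) → Fin k → Carrier
  fibre σ g j = sum (λ i → 𝟙 (σ i == j) * g i)

  sum-fibres : ∀ {n k} (σ : Fin n → Fin k) (f : Fin k → Carrier) (g : Fin n → Carrier) →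
               sum (λ i → f (σ i) * g i) ≈ sum (λ j → f j * fibre σ g j)
  sum-fibres {n} {k} σ f g = begin-equality
    sum (λ i → f (σ i) * g i)
      ≈⟨ sum-cong (λ i → sym (sum-pick (σ i) (λ j → f j * g i))) ⟩
    sum (λ i → sum (λ j → 𝟙 (σ i == j) * (f j * g i)))
      ≈⟨ sum-swap (λ i j → 𝟙 (σ i == j) * (f j * g i)) ⟩
    sum (λ j → sum (λ i → 𝟙 (σ i == j) * (f j * g i)))
      ≈⟨ sum-cong (λ j → sum-cong (λ i → begin-equality
           𝟙 (σ i == j) * (f j * g i) ≈⟨ *-assoc _ _ _ ⟨
           𝟙 (σ i == j) * f j * g i   ≈⟨ *-congʳ (*-comm _ _) ⟩
           f j * 𝟙 (σ i == j) * g i   ≈⟨ *-assoc _ _ _ ⟩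
           f j * (𝟙 (σ i == j) * g i) ∎)) ⟩
    sum (λ j → sum (λ i → f j * (𝟙 (σ i == j) * g i)))
      ≈⟨ sum-cong (λ j → *-sum {n} (f j) _) ⟩
    sum (λ j → f j * fibre σ g j) ∎

  -- Sampling without replacement at a fixed level

  -- For nonnegative arguments with P + Q = 0 the numerator is 0, so the ratio is 0 whatever the
  -- unspecified inverse of 0 is.
  ratio : Carrier → Carrier → Carrier
  ratio P Q = P / (P + Q)

  ratio-≤ : ∀ {P Q x} → 0# ≤ P → 0# ≤ Q → 0# ≤ x → P ≤ x * (P + Q) → ratio P Q ≤ x
  ratio-≤ {P} {Q} {x} 0≤P 0≤Q 0≤x P≤ with 0# ≈? (P + Q)
  ... | no 0≉T  = x≤y*z⇒x/z≤y (+-nonNeg 0≤P 0≤Q , 0≉T) P≤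
  ... | yes 0≈T = begin
    P / (P + Q)              ≤⟨ ≤-reflexive (*-congʳ P≈0) ⟩
    0# * (P + Q) ⁻¹          ≈⟨ zeroˡ _ ⟩
    0#                       ≤⟨ 0≤x ⟩
    x                        ∎
    where
    P≈0 : P ≈ 0#
    P≈0 = ≤-antisym (≤-trans (≤-slack 0≤Q refl) (≤-reflexive (sym 0≈T))) 0≤P

  ratio*total : ∀ {P Q} → 0# ≤ P → 0# ≤ Q → ratio P Q * (P + Q) ≈ P
  ratio*total {P} {Q} 0≤P 0≤Q with 0# ≈? (P + Q)
  ... | no 0≉T  = x*y/y≈x P (+-nonNeg 0≤P 0≤Q , 0≉T)
  ... | yes 0≈T = begin-equality
    ratio P Q * (P + Q) ≈⟨ *-congˡ 0≈T ⟨
    ratio P Q * 0#      ≈⟨ zeroʳ _ ⟩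
    0#                  ≈⟨ ≤-antisym (≤-trans (≤-slack 0≤Q refl) (≤-reflexive (sym 0≈T))) 0≤P ⟨
    P                   ∎

  0≤ratio : ∀ {P Q} → 0# ≤ P → 0# ≤ Q → 0# ≤ ratio P Q
  0≤ratio {P} {Q} 0≤P 0≤Q with 0# ≈? (P + Q)
  ... | no 0≉T  = *-nonNeg 0≤P (proj₁ (⁻¹-pos (+-nonNeg 0≤P 0≤Q , 0≉T)))
  ... | yes 0≈T = ≤-reflexive (sym (trans (*-congʳ
    (≤-antisym (≤-trans (≤-slack 0≤Q refl) (≤-reflexive (sym 0≈T))) 0≤P)) (zeroˡ _)))

  ratio≤1 : ∀ {P Q} → 0# ≤ P → 0# ≤ Q → ratio P Q ≤ 1#
  ratio≤1 0≤P 0≤Q = ratio-≤ 0≤P 0≤Q 0≤1 (≤-trans (≤-slack 0≤Q refl) (≤-reflexive (sym (*-identityˡ _))))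

  -- For x = `ratio P Q` one has (1 - x) P = x Q, hence (1 - x) P′ ≤ x Q ≤ x Q′. Adding x P′ gives
  -- P′ ≤ x (P′ + Q′).
  ratio-mono : ∀ {P P′ Q Q′} → 0# ≤ P′ → 0# ≤ Q → P′ ≤ P → Q ≤ Q′ → ratio P′ Q′ ≤ ratio P Q
  ratio-mono {P} {P′} {Q} {Q′} 0≤P′ 0≤Q P′≤P Q≤Q′ =
    ratio-≤ 0≤P′ (≤-trans 0≤Q Q≤Q′) (0≤ratio 0≤P 0≤Q) (begin
      P′                           ≈⟨ solve 2 (λ x P′ → P′ := x :* P′ :+ (con (pos 1) :- x) :* P′) refl x P′ ⟩
      x * P′ + (1# - x) * P′       ≤⟨ +-monoʳ-≤ _ (*-monoʳ-≤ (x≤y⇒0≤y-x (ratio≤1 0≤P 0≤Q)) P′≤P) ⟩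
      x * P′ + (1# - x) * P        ≈⟨ solve 3 (λ x P P′ → x :* P′ :+ (con (pos 1) :- x) :* P
                                        := x :* P′ :+ (P :- x :* P)) refl x P P′ ⟩
      x * P′ + (P - x * P)         ≈⟨ +-congˡ (+-congʳ (ratio*total 0≤P 0≤Q)) ⟨
      x * P′ + (x * (P + Q) - x * P) ≈⟨ solve 4 (λ x P P′ Q → x :* P′ :+ (x :* (P :+ Q) :- x :* P)
                                        := x :* P′ :+ x :* Q) refl x P P′ Q ⟩
      x * P′ + x * Q               ≤⟨ +-monoʳ-≤ _ (*-monoʳ-≤ (0≤ratio 0≤P 0≤Q) Q≤Q′) ⟩
      x * P′ + x * Q′              ≈⟨ distribˡ x P′ Q′ ⟨
      x * (P′ + Q′)                ∎)
    where
    x = ratio P Q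
    0≤P = ≤-trans 0≤P′ P′≤P

  -- π and χ tell whether P or Q loses an element. For T = P + Q > 1 take κ to be
  -- 1 / (T (T - 1)); for T ≤ 1 a removal leaves nothing in P, and κ = 0 does.
  ratio-removal : ∀ {P Q} → 0# ≤ P → 0# ≤ Q → ∃ λ κ → 0# ≤ κ ×
    (∀ π χ {P′ Q′} → π ∧ χ ≡ false → 0# ≤ P′ → 0# ≤ Q′ →
      P′ + 𝟙 π ≤ P → Q ≤ Q′ + 𝟙 χ → 𝟙 χ ≤ Q →
      ratio P′ Q′ + κ * (Q * 𝟙 π) ≤ ratio P Q + κ * (P * 𝟙 χ))
  ratio-removal {P} {Q} 0≤P 0≤Q = by-total (1# ≤? (P + Q)) ((P + Q) ≤? 1#)
    where
    Goal : Carrier → Bool → Bool → Set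
    Goal κ π χ = ∀ {P′ Q′} → π ∧ χ ≡ false → 0# ≤ P′ → 0# ≤ Q′ →
      P′ + 𝟙 π ≤ P → Q ≤ Q′ + 𝟙 χ → 𝟙 χ ≤ Q →
      ratio P′ Q′ + κ * (Q * 𝟙 π) ≤ ratio P Q + κ * (P * 𝟙 χ)

    unchanged : ∀ κ → Goal κ false false
    unchanged κ {P′} {Q′} _ 0≤P′ 0≤Q′ P′≤ Q≤ _ = +-mono-≤
      (ratio-mono 0≤P′ 0≤Q (≤-trans (≤-reflexive (sym (+-identityʳ P′))) P′≤)
        (≤-trans Q≤ (≤-reflexive (+-identityʳ Q′))))
      (≤-reflexive (*-congˡ (trans (zeroʳ Q) (sym (zeroʳ P)))))

    emptied : ∀ {P′ Q′ y z} → P′ ≤ 0# → 0# ≤ P′ → 0# ≤ Q′ → ratio P′ Q′ + 0# * y ≤ ratio P Q + 0# * z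
    emptied P′≤0 0≤P′ 0≤Q′ = +-mono-≤
      (ratio-≤ 0≤P′ 0≤Q′ (0≤ratio 0≤P 0≤Q)
        (≤-trans P′≤0 (*-nonNeg (0≤ratio 0≤P 0≤Q) (+-nonNeg 0≤P′ 0≤Q′))))
      (≤-reflexive (trans (zeroˡ _) (sym (zeroˡ _))))

    by-total : Dec (1# ≤ (P + Q)) → Dec ((P + Q) ≤ 1#) →
      ∃ λ κ → 0# ≤ κ × (∀ π χ → Goal κ π χ)
    by-total _ (yes T≤1) = 0# , ≤-refl , goal
      where
      goal : ∀ π χ → Goal 0# π χ
      goal false false = unchanged 0#
      goal true  false {P′} _ 0≤P′ 0≤Q′ P′≤ _ _ = emptied (≤-slack (x≤y⇒0≤y-x (begin
          P′ + 1#  ≤⟨ P′≤ ⟩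
          P        ≤⟨ ≤-slack 0≤Q refl ⟩
          P + Q    ≤⟨ T≤1 ⟩
          1#       ∎)) (solve 1 (λ P′ → con (pos 0) := P′ :+ (con (pos 1) :- (P′ :+ con (pos 1)))) refl P′)) 0≤P′ 0≤Q′
      goal false true {P′} _ 0≤P′ 0≤Q′ P′≤ _ 1≤Q = emptied (≤-slack (x≤y⇒0≤y-x (begin
          P′ + 1#        ≤⟨ +-mono-≤ (≤-trans (≤-reflexive (sym (+-identityʳ P′))) P′≤) 1≤Q ⟩
          P + Q    ≤⟨ T≤1 ⟩
          1#       ∎)) (solve 1 (λ P′ → con (pos 0) := P′ :+ (con (pos 1) :- (P′ :+ con (pos 1)))) refl P′)) 0≤P′ 0≤Q′
    by-total (no 1≰T) (no T≰1) with total 1# (P + Q)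
    ... | inj₁ 1≤T = contradiction 1≤T 1≰T
    ... | inj₂ T≤1 = contradiction T≤1 T≰1
    by-total (yes 1≤T) (no T≰1) = κ , *-nonNeg (proj₁ (⁻¹-pos 0<T)) (proj₁ (⁻¹-pos 0<u)) , goal
      where
      T = P + Q
      u = T - 1#
      κ = T ⁻¹ * u ⁻¹

      0<T : 0# < T
      0<T = <-≤-trans 0<1 1≤T

      0<u : 0# < u
      0<u = x≤y⇒0≤y-x 1≤T , λ 0≈u → T≰1 (≤-reflexive (begin-equality
        T           ≈⟨ solve 1 (λ T → T := (T :- con (pos 1)) :+ con (pos 1)) refl T ⟩
        u + 1#      ≈⟨ +-congʳ 0≈u ⟨
        0# + 1#     ≈⟨ +-identityˡ 1# ⟩
        1#          ∎))

      -- κ is the reciprocal of the common denominator T u of the ratios before and after a removal.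
      -- Cleared of it, the two removal cases are the identities (P - 1) T + Q = P u and P T = P u +
      -- P.
      scaled : ∀ x → x * u ⁻¹ ≈ κ * (x * T)
      scaled x = begin-equality
        x * u ⁻¹                ≈⟨ *-identityʳ _ ⟨
        x * u ⁻¹ * 1#           ≈⟨ *-congˡ (⁻¹-inverseʳ 0<T) ⟨
        x * u ⁻¹ * (T * T ⁻¹)   ≈⟨ solve 4 (λ x v T t → x :* v :* (T :* t) := t :* v :* (x :* T)) refl x (u ⁻¹) T (T ⁻¹) ⟩
        κ * (x * T)             ∎

      scaledT : ∀ x → x * T ⁻¹ ≈ κ * (x * u)
      scaledT x = begin-equality
        x * T ⁻¹                ≈⟨ *-identityʳ _ ⟨
        x * T ⁻¹ * 1#           ≈⟨ *-congˡ (⁻¹-inverseʳ 0<u) ⟨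
        x * T ⁻¹ * (u * u ⁻¹)   ≈⟨ solve 4 (λ x v u t → x :* t :* (u :* v) := t :* v :* (x :* u)) refl x (u ⁻¹) u (T ⁻¹) ⟩
        κ * (x * u)             ∎

      goal : ∀ π χ → Goal κ π χ
      goal false false = unchanged κ
      goal true false {P′} {Q′} _ 0≤P′ 0≤Q′ P′≤ Q≤ _ = begin
        ratio P′ Q′ + κ * (Q * 1#)
          ≤⟨ +-monoˡ-≤ _ (ratio-mono 0≤P′ 0≤Q
               (≤-slack (x≤y⇒0≤y-x P′≤) (solve 2 (λ P P′ → P :- con (pos 1) := P′ :+ (P :- (P′ :+ con (pos 1)))) refl P P′))
               (≤-trans Q≤ (≤-reflexive (+-identityʳ Q′)))) ⟩
        (P - 1#) / (P - 1# + Q) + κ * (Q * 1#)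
          ≈⟨ +-congʳ (*-congˡ (⁻¹-cong (solve 2 (λ P Q → P :- con (pos 1) :+ Q := P :+ Q :- con (pos 1)) refl P Q))) ⟩
        (P - 1#) * u ⁻¹ + κ * (Q * 1#)
          ≈⟨ +-congʳ (scaled _) ⟩
        κ * ((P - 1#) * T) + κ * (Q * 1#)
          ≈⟨ solve 3 (λ κ P Q → κ :* ((P :- con (pos 1)) :* (P :+ Q)) :+ κ :* (Q :* con (pos 1))
               := κ :* (P :* (P :+ Q :- con (pos 1))) :+ κ :* (P :* con (pos 0))) refl κ P Q ⟩
        κ * (P * u) + κ * (P * 0#)
          ≈⟨ +-congʳ (scaledT P) ⟨
        ratio P Q + κ * (P * 0#) ∎
      goal false true {P′} {Q′} _ 0≤P′ 0≤Q′ P′≤ Q≤ 1≤Q = begin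
        ratio P′ Q′ + κ * (Q * 0#)
          ≤⟨ +-monoˡ-≤ _ (ratio-mono 0≤P′ (x≤y⇒0≤y-x 1≤Q) (≤-trans (≤-reflexive (sym (+-identityʳ P′))) P′≤)
               (≤-slack (x≤y⇒0≤y-x Q≤) (solve 2 (λ Q Q′ → Q′ := Q :- con (pos 1) :+ (Q′ :+ con (pos 1) :- Q)) refl Q Q′))) ⟩
        P / (P + (Q - 1#)) + κ * (Q * 0#)
          ≈⟨ +-congʳ (*-congˡ (⁻¹-cong (sym (+-assoc P Q (- 1#))))) ⟩
        P * u ⁻¹ + κ * (Q * 0#)
          ≈⟨ +-congʳ (scaled P) ⟩
        κ * (P * T) + κ * (Q * 0#)
          ≈⟨ solve 3 (λ κ P Q → κ :* (P :* (P :+ Q)) :+ κ :* (Q :* con (pos 0))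
               := κ :* (P :* (P :+ Q :- con (pos 1))) :+ κ :* (P :* con (pos 1))) refl κ P Q ⟩
        κ * (P * u) + κ * (P * 1#)
          ≈⟨ +-congʳ (scaledT P) ⟨
        ratio P Q + κ * (P * 1#) ∎

  -- Layer-cake decomposition over finitely many levels

  open Sort decTotalOrder using (sort; sort-↭; sort-↗)

  -- A discrete measure (mass Δ l at level θ l) under which [a , x] has mass at most
  -- x - a, with equality for x ∈ V.
  record Layers (a : Carrier) (V : List Carrier) : Set where
    field
      {size} : ℕ
      Δ θ    : Fin size → Carrier
      0≤Δ    : ∀ l → 0# ≤ Δ l
      a≤θ    : ∀ l → a ≤ θ l
      below  : ∀ {x} → a ≤ x → a + sum (λ l → Δ l * 𝟙 (θ l ≤ᵇ x)) ≤ x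
      above  : ∀ {x} → x ∈ V → x ≤ a + sum (λ l → Δ l * 𝟙 (θ l ≤ᵇ x))

  -- Each gap between consecutive values becomes a mass at its upper end, so `a` plus the masses up
  -- to x telescopes to the largest value not exceeding x, or to `a` if there is none.
  layers-ascending : ∀ a V → All (a ≤_) V → AllPairs _≤_ V → Layers a V
  layers-ascending a List.[] All.[] _ = record
    { Δ = Vector.[] ; θ = Vector.[] ; 0≤Δ = λ () ; a≤θ = λ ()
    ; below = λ a≤x → ≤-trans (≤-reflexive (+-identityʳ a)) a≤x ; above = λ () }
  layers-ascending a (v List.∷ V) (a≤v All.∷ _) (v≤V AllPairs.∷ V↗) = record
    { Δ = Δ′ ; θ = θ′
    ; 0≤Δ = λ { Fin.zero → x≤y⇒0≤y-x a≤v ; (Fin.suc l) → 0≤Δ l }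
    ; a≤θ = λ { Fin.zero → a≤v ; (Fin.suc l) → ≤-trans a≤v (a≤θ l) }
    ; below = below′ ; above = above′ }
    where
    open Layers (layers-ascending v V v≤V V↗)
    Δ′ = (v - a) Vector.∷ Δ
    θ′ = v Vector.∷ θ

    rest : Carrier → Carrier
    rest x = sum (λ l → Δ l * 𝟙 (θ l ≤ᵇ x))

    0≤rest : ∀ x → 0# ≤ rest x
    0≤rest x = 0≤sum _ (λ l → *-nonNeg (0≤Δ l) (0≤𝟙 (θ l ≤ᵇ x)))

    passed : ∀ x → a + ((v - a) * 1# + rest x) ≈ v + rest x
    passed x = solve 3 (λ a v r → a :+ ((v :- a) :* con (pos 1) :+ r) := v :+ r) refl a v (rest x)

    below′ : ∀ {x} → a ≤ x → a + ((v - a) * 𝟙 (v ≤ᵇ x) + rest x) ≤ x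
    below′ {x} a≤x with v ≤? x
    ... | yes v≤x = ≤-trans (≤-reflexive (passed x)) (below v≤x)
    ... | no v≰x  = begin
      a + ((v - a) * 0# + rest x) ≈⟨ +-congˡ (+-cong (zeroʳ _) (sum-0 zero-layer)) ⟩
      a + (0# + 0#)               ≈⟨ trans (+-congˡ (+-identityʳ 0#)) (+-identityʳ a) ⟩
      a                           ≤⟨ a≤x ⟩
      x                           ∎
      where
      zero-layer : ∀ l → Δ l * 𝟙 (θ l ≤ᵇ x) ≈ 0#
      zero-layer l with θ l ≤? x
      ... | yes θ≤x = contradiction (≤-trans (a≤θ l) θ≤x) v≰x
      ... | no _    = zeroʳ _

    above′ : ∀ {x} → x ∈ v List.∷ V → x ≤ a + ((v - a) * 𝟙 (v ≤ᵇ x) + rest x)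
    above′ {x} x∈ with v ≤? x
    above′ {x} (here ≡.refl) | yes _ = ≤-trans (≤-slack (0≤rest x) refl) (≤-reflexive (sym (passed x)))
    above′ {x} (there x∈V)   | yes _ = ≤-trans (above x∈V) (≤-reflexive (sym (passed x)))
    above′ {x} (here ≡.refl) | no v≰x = contradiction ≤-refl v≰x
    above′ {x} (there x∈V)   | no v≰x = contradiction (All.lookup v≤V x∈V) v≰x

  layers : ∀ a V → All (a ≤_) V → Layers a V
  layers a V a≤V = record
    { Δ = Δ ; θ = θ ; 0≤Δ = 0≤Δ ; a≤θ = a≤θ ; below = below
    ; above = λ x∈V → above (Permutation.∈-resp-↭ (↭-sym (sort-↭ V)) x∈V) }
    where
    open Layers (layers-ascending a (sort V)
      (Permutation.All-resp-↭ (↭-sym (sort-↭ V)) a≤V)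
      (Linked.Linked⇒AllPairs ≤-trans (sort-↗ V)))

  -- Proportion of high clusters at one level

  module Survival {k : ℕ} (ρ : Carrier) (1≤ρ : 1# ≤ ρ) where

    0≤ρ : 0# ≤ ρ
    0≤ρ = ≤-trans 0≤1 1≤ρ

    x≤ρx : ∀ {x} → 0# ≤ x → x ≤ ρ * x
    x≤ρx 0≤x = ≤-trans (≤-reflexive (sym (*-identityˡ _))) (*-monoˡ-≤ 0≤x 1≤ρ)

    count : (Fin k → Bool) → Carrier
    count b = sum (λ j → 𝟙 (b j))

    0≤count : ∀ b → 0# ≤ count b
    0≤count b = 0≤sum _ (λ j → 0≤𝟙 (b j))

    remove : (Fin k → Bool) → Fin k → Fin k → Bool
    remove alive j l = alive l ∧ not (j == l)

    -- Unhit clusters with θ / ρ ≤ w < θ belong to neither class; this gap is as wide as the noise.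
    high low : Carrier → (Fin k → Bool) → (Fin k → Carrier) → Fin k → Bool
    high θ alive w j = alive j ∧ (θ ≤ᵇ w j)
    low  θ alive w j = alive j ∧ not (θ ≤ᵇ ρ * w j)

    survival : Carrier → (Fin k → Bool) → (Fin k → Carrier) → Carrier
    survival θ alive w = ratio (count (high θ alive w)) (count (low θ alive w))

    0≤survival : ∀ θ alive w → 0# ≤ survival θ alive w
    0≤survival θ alive w = 0≤ratio (0≤count (high θ alive w)) (0≤count (low θ alive w))

    high-low-disjoint : ∀ θ alive {w} → (∀ j → 0# ≤ w j) →
                        ∀ j → high θ alive w j ∧ low θ alive w j ≡ false
    high-low-disjoint θ alive {w} 0≤w j with alive j | θ ≤? w j | θ ≤? ρ * w j
    ... | false | _       | _        = ≡.refl
    ... | true  | no _    | _        = ≡.refl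
    ... | true  | yes _   | yes _    = ≡.refl
    ... | true  | yes θ≤w | no θ≰ρw  = contradiction (≤-trans θ≤w (x≤ρx (0≤w j))) θ≰ρw

    module _ (θ : Carrier) (alive : Fin k → Bool) {w : Fin k → Carrier} where

      private
        H = high θ alive w
        L = low θ alive w

      -- Falling costs can only move clusters out of the high class, so no new one compensates for
      -- the loss of `j`.
      count-high-removal : ∀ j {w′} → (∀ l → w′ l ≤ w l) →
        count (high θ (remove alive j) w′) + 𝟙 (H j) ≤ count H
      count-high-removal j {w′} w′≤w = begin
        count (high θ (remove alive j) w′) + 𝟙 (H j)
          ≈⟨ +-congˡ (sum-pick j (λ l → 𝟙 (H l))) ⟨
        count (high θ (remove alive j) w′) + sum (λ l → 𝟙 (j == l) * 𝟙 (H l))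
          ≈⟨ sum-+ {k} _ _ ⟨
        sum (λ l → 𝟙 (high θ (remove alive j) w′ l) + 𝟙 (j == l) * 𝟙 (H l))
          ≤⟨ sum-mono {k} pointwise ⟩
        count H ∎
        where
        pointwise : ∀ l → 𝟙 (high θ (remove alive j) w′ l) + 𝟙 (j == l) * 𝟙 (H l) ≤ 𝟙 (H l)
        pointwise l with alive l | j == l
        ... | false | b     = ≤-reflexive (trans (+-identityˡ _) (zeroʳ _))
        ... | true  | true  = ≤-reflexive (trans (+-identityˡ _) (*-identityˡ _))
        ... | true  | false = ≤-trans (≤-reflexive (trans (+-congˡ (zeroˡ _)) (+-identityʳ _)))
                                      (𝟙-≤ᵇ-mono (w′≤w l))

      -- Falling costs can only move clusters into the low class, so `j` is the only member it can
      -- lose.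
      count-low-removal : ∀ j {w′} → (∀ l → w′ l ≤ w l) →
        count L ≤ count (low θ (remove alive j) w′) + 𝟙 (L j)
      count-low-removal j {w′} w′≤w = begin
        count L
          ≤⟨ sum-mono {k} pointwise ⟩
        sum (λ l → 𝟙 (low θ (remove alive j) w′ l) + 𝟙 (j == l) * 𝟙 (L l))
          ≈⟨ sum-+ {k} _ _ ⟩
        count (low θ (remove alive j) w′) + sum (λ l → 𝟙 (j == l) * 𝟙 (L l))
          ≈⟨ +-congˡ (sum-pick j (λ l → 𝟙 (L l))) ⟩
        count (low θ (remove alive j) w′) + 𝟙 (L j) ∎
        where
        pointwise : ∀ l → 𝟙 (L l) ≤ 𝟙 (low θ (remove alive j) w′ l) + 𝟙 (j == l) * 𝟙 (L l)
        pointwise l with alive l | j == l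
        ... | false | b     = ≤-reflexive (sym (trans (+-identityˡ _) (zeroʳ _)))
        ... | true  | true  = ≤-reflexive (sym (trans (+-identityˡ _) (*-identityˡ _)))
        ... | true  | false = ≤-trans (𝟙-≰ᵇ-mono (*-monoʳ-≤ 0≤ρ (w′≤w l)))
                                      (≤-reflexive (sym (trans (+-congˡ (zeroˡ _)) (+-identityʳ _))))

      -- κ depends on the old counts alone and is the same for every `j` and `w′`. This is what
      -- allows the inequality to be averaged over the random cluster hit.
      survival-removal : (∀ l → 0# ≤ w l) → ∃ λ κ → 0# ≤ κ ×
        (∀ j {w′} → (∀ l → w′ l ≤ w l) →
          survival θ (remove alive j) w′ + κ * (count L * 𝟙 (H j))
            ≤ survival θ alive w + κ * (count H * 𝟙 (L j)))
      survival-removal 0≤w with ratio-removal (0≤count H) (0≤count L)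
      ... | κ , 0≤κ , removal = κ , 0≤κ , λ j w′≤w →
        removal (H j) (L j) (high-low-disjoint θ alive 0≤w j)
          (0≤count (high θ (remove alive j) _)) (0≤count (low θ (remove alive j) _))
          (count-high-removal j w′≤w) (count-low-removal j w′≤w)
          (term≤sum (λ l → 𝟙 (L l)) (λ l → 0≤𝟙 (L l)) j)

      -- A cluster hit before is neither high nor low, so both correction terms vanish. The bound
      -- holds for each outcome, not only in expectation.
      survival-dead : (∀ l → 0# ≤ w l) → ∀ j {w′} → alive j ≡ false → (∀ l → w′ l ≤ w l) →
        survival θ (remove alive j) w′ ≤ survival θ alive w
      survival-dead 0≤w j {w′} dead w′≤w with survival-removal 0≤w
      ... | κ , _ , removal = begin
        survival θ (remove alive j) w′                              ≈⟨ +-identityʳ _ ⟨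
        survival θ (remove alive j) w′ + 0#                         ≈⟨ +-congˡ (vanish (count L) (≡.cong (_∧ (θ ≤ᵇ w j)) dead)) ⟨
        survival θ (remove alive j) w′ + κ * (count L * 𝟙 (H j))    ≤⟨ removal j w′≤w ⟩
        survival θ alive w + κ * (count H * 𝟙 (L j))                ≈⟨ +-congˡ (vanish (count H) (≡.cong (_∧ not (θ ≤ᵇ ρ * w j)) dead)) ⟩
        survival θ alive w + 0#                                     ≈⟨ +-identityʳ _ ⟩
        survival θ alive w                                          ∎
        where
        vanish : ∀ {b} x → b ≡ false → κ * (x * 𝟙 b) ≈ 0#
        vanish x ≡.refl = trans (*-congˡ (zeroʳ x)) (zeroʳ κ)

    -- In use, α is 1 - ε over the total cost and ρ α is 1 + ε over it, so the last two bounds are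
    -- the noisy sampling rule.
    module Step {n} (σ : Fin n → Fin k) {q D : Fin n → Carrier} {α : Carrier}
                (0≤q : ∀ i → 0# ≤ q i) (Σq≈1 : sum q ≈ 1#) (0≤D : ∀ i → 0# ≤ D i) (0≤α : 0# ≤ α)
                (αD≤q : ∀ i → α * D i ≤ q i) (q≤ραD : ∀ i → q i ≤ ρ * (α * D i)) where

      private
        w = fibre σ D

      0≤w : ∀ j → 0# ≤ w j
      0≤w j = 0≤sum _ (λ i → *-nonNeg (0≤𝟙 (σ i == j)) (0≤D i))

      average-const : ∀ c → sum (λ i → q i * c) ≈ c
      average-const c = begin-equality
        sum (λ i → q i * c) ≈⟨ sum-cong {n} (λ i → *-comm (q i) c) ⟩
        sum (λ i → c * q i) ≈⟨ *-sum {n} c q ⟩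
        c * sum q           ≈⟨ *-congˡ Σq≈1 ⟩
        c * 1#              ≈⟨ *-identityʳ c ⟩
        c                   ∎

      average-linear : ∀ c d (f : Fin n → Carrier) →
        sum (λ i → q i * (c + d * f i)) ≈ c + d * sum (λ i → f i * q i)
      average-linear c d f = begin-equality
        sum (λ i → q i * (c + d * f i))
          ≈⟨ sum-cong {n} (λ i → solve 4 (λ q c d f → q :* (c :+ d :* f) := q :* c :+ d :* (f :* q)) refl (q i) c d (f i)) ⟩
        sum (λ i → q i * c + d * (f i * q i))
          ≈⟨ trans (sum-+ {n} _ _) (+-cong (average-const c) (*-sum {n} d _)) ⟩
        c + d * sum (λ i → f i * q i) ∎

      module _ (θ : Carrier) (alive : Fin k → Bool) where

        private
          H = high θ alive w
          L = low θ alive w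
          P = count H
          Q = count L

        high-mass : α * (θ * P) ≤ sum (λ i → 𝟙 (H (σ i)) * q i)
        high-mass = begin
          α * (θ * P)                          ≈⟨ *-congˡ (*-sum {k} θ _) ⟨
          α * sum (λ j → θ * 𝟙 (H j))          ≤⟨ *-monoʳ-≤ 0≤α (sum-mono {k} pointwise) ⟩
          α * sum (λ j → 𝟙 (H j) * w j)        ≈⟨ *-congˡ (sum-fibres σ (λ j → 𝟙 (H j)) D) ⟨
          α * sum (λ i → 𝟙 (H (σ i)) * D i)    ≈⟨ *-sum {n} α _ ⟨
          sum (λ i → α * (𝟙 (H (σ i)) * D i))  ≤⟨ sum-mono {n} (λ i → ≤-trans
                                                   (≤-reflexive (solve 3 (λ α b D → α :* (b :* D) := b :* (α :* D)) refl α _ (D i)))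
                                                   (*-monoʳ-≤ (0≤𝟙 (H (σ i))) (αD≤q i))) ⟩
          sum (λ i → 𝟙 (H (σ i)) * q i)        ∎
          where
          pointwise : ∀ j → θ * 𝟙 (H j) ≤ 𝟙 (H j) * w j
          pointwise j with alive j
          ... | true  = ≤-trans (≤-reflexive (*-comm θ _)) (𝟙-≤ᵇ-* θ (w j))
          ... | false = ≤-reflexive (trans (zeroʳ θ) (sym (zeroˡ (w j))))

        -- The factor ρ in the upper bound on `q` is absorbed by ρ w < θ, which defines the low
        -- class. The constant α θ is therefore the same as in `high-mass`.
        low-mass : sum (λ i → 𝟙 (L (σ i)) * q i) ≤ α * (θ * Q)
        low-mass = begin
          sum (λ i → 𝟙 (L (σ i)) * q i)              ≤⟨ sum-mono {n} (λ i → ≤-trans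
                                                         (*-monoʳ-≤ (0≤𝟙 (L (σ i))) (q≤ραD i))
                                                         (≤-reflexive (solve 4 (λ α ρ b D → b :* (ρ :* (α :* D)) := α :* (ρ :* (b :* D))) refl α ρ _ (D i)))) ⟩
          sum (λ i → α * (ρ * (𝟙 (L (σ i)) * D i)))  ≈⟨ trans (*-sum {n} α _) (*-congˡ (*-sum {n} ρ _)) ⟩
          α * (ρ * sum (λ i → 𝟙 (L (σ i)) * D i))    ≈⟨ *-congˡ (*-congˡ (sum-fibres σ (λ j → 𝟙 (L j)) D)) ⟩
          α * (ρ * sum (λ j → 𝟙 (L j) * w j))        ≈⟨ *-congˡ (*-sum {k} ρ _) ⟨
          α * sum (λ j → ρ * (𝟙 (L j) * w j))        ≤⟨ *-monoʳ-≤ 0≤α (sum-mono {k} pointwise) ⟩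
          α * sum (λ j → θ * 𝟙 (L j))                ≈⟨ *-congˡ (*-sum {k} θ _) ⟩
          α * (θ * Q)                                ∎
          where
          pointwise : ∀ j → ρ * (𝟙 (L j) * w j) ≤ θ * 𝟙 (L j)
          pointwise j with alive j
          ... | false = ≤-reflexive (trans (*-congˡ (zeroˡ (w j))) (trans (zeroʳ ρ) (sym (zeroʳ θ))))
          ... | true  = begin
            ρ * (b * w j) ≈⟨ solve 3 (λ ρ b w → ρ :* (b :* w) := b :* (ρ :* w)) refl ρ b (w j) ⟩
            b * (ρ * w j) ≤⟨ 𝟙-≰ᵇ-* θ (ρ * w j) ⟩
            b * θ         ≈⟨ *-comm b θ ⟩
            θ * b         ∎
            where b = 𝟙 (not (θ ≤ᵇ ρ * w j))

        -- The expected corrections in `survival-removal` cancel: a high hit has probability at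
        -- least α θ P, a low hit at most α θ Q, and Q (α θ P) = P (α θ Q).
        survival-supermartingale : {w′ : Fin n → Fin k → Carrier} → (∀ i l → w′ i l ≤ w l) →
          sum (λ i → q i * survival θ (remove alive (σ i)) (w′ i)) ≤ survival θ alive w
        survival-supermartingale {w′} w′≤w with survival-removal θ alive {w} 0≤w
        ... | κ , 0≤κ , removal = ≤-slack (x≤y⇒0≤y-x shifted) (solve 3 (λ x y z →
                 y := x :+ ((y :+ z) :- (x :+ z))) refl
                 (sum (λ i → q i * S′ i)) S (κ * (Q * (α * (θ * P)))))
          where
          S = survival θ alive w
          S′ : Fin n → Carrier
          S′ i = survival θ (remove alive (σ i)) (w′ i)
          shifted : sum (λ i → q i * S′ i) + κ * (Q * (α * (θ * P))) ≤ S + κ * (Q * (α * (θ * P)))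
          shifted = begin
            sum (λ i → q i * S′ i) + κ * (Q * (α * (θ * P)))
              ≤⟨ +-monoʳ-≤ _ (*-monoʳ-≤ 0≤κ (*-monoʳ-≤ (0≤count L) high-mass)) ⟩
            sum (λ i → q i * S′ i) + κ * (Q * sum (λ i → 𝟙 (H (σ i)) * q i))
              ≈⟨ +-congˡ (trans (*-sum {n} κ _) (*-congˡ (*-sum {n} Q _))) ⟨
            sum (λ i → q i * S′ i) + sum (λ i → κ * (Q * (𝟙 (H (σ i)) * q i)))
              ≈⟨ sum-+ {n} _ _ ⟨
            sum (λ i → q i * S′ i + κ * (Q * (𝟙 (H (σ i)) * q i)))
              ≤⟨ sum-mono {n} (λ i → ≤-trans
                   (≤-reflexive (solve 5 (λ q S κ Q b → q :* S :+ κ :* (Q :* (b :* q)) := q :* (S :+ κ :* (Q :* b)))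
                     refl (q i) (S′ i) κ Q _))
                   (*-monoʳ-≤ (0≤q i) (≤-trans (removal (σ i) (w′≤w i)) (≤-reflexive (+-congˡ (sym (*-assoc _ _ _))))))) ⟩
            sum (λ i → q i * (S + κ * P * 𝟙 (L (σ i))))
              ≈⟨ average-linear S (κ * P) (λ i → 𝟙 (L (σ i))) ⟩
            S + κ * P * sum (λ i → 𝟙 (L (σ i)) * q i)
              ≤⟨ +-monoʳ-≤ S (*-monoʳ-≤ (*-nonNeg 0≤κ (0≤count H)) low-mass) ⟩
            S + κ * P * (α * (θ * Q))
              ≈⟨ +-congˡ (solve 5 (λ κ P α θ Q → κ :* P :* (α :* (θ :* Q)) := κ :* (Q :* (α :* (θ :* P)))) refl κ P α θ Q) ⟩
            S + κ * (Q * (α * (θ * P))) ∎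

    -- The potential G: survival integrated over all levels

    module Potential {V : List Carrier} (cake : Layers 0# V) where

      open Layers cake

      G : (Fin k → Bool) → (Fin k → Carrier) → Carrier
      G alive w = sum (λ l → Δ l * survival (θ l) alive w)

      0≤G : ∀ alive w → 0# ≤ G alive w
      0≤G alive w = 0≤sum _ (λ l → *-nonNeg (0≤Δ l) (0≤survival (θ l) alive w))

      G-dead : ∀ alive {w w′} → (∀ l → 0# ≤ w l) → ∀ j → alive j ≡ false → (∀ l → w′ l ≤ w l) →
               G (remove alive j) w′ ≤ G alive w
      G-dead alive 0≤w j dead w′≤w =
        sum-mono {size} (λ l → *-monoʳ-≤ (0≤Δ l) (survival-dead (θ l) alive 0≤w j dead w′≤w))

      module _ (alive : Fin k → Bool) {w : Fin k → Carrier} (0≤w : ∀ j → 0# ≤ w j) where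

        private
          u = count alive

        module _ (θ : Carrier) where

          private
            P = count (high θ alive w)
            Q = count (low θ alive w)
            A = sum (λ j → 𝟙 (alive j) * 𝟙 (θ ≤ᵇ ρ * w j))
            S = survival θ alive w

          P≤A : P ≤ A
          P≤A = sum-mono {k} (λ j → ≤-trans (≤-reflexive (𝟙-∧ (alive j) _))
            (*-monoʳ-≤ (0≤𝟙 (alive j)) (𝟙-≤ᵇ-mono (x≤ρx (0≤w j)))))

          u≈A+Q : u ≈ A + Q
          u≈A+Q = begin-equality
            u ≈⟨ sum-cong {k} (λ j → begin-equality
                   𝟙 (alive j)                                        ≈⟨ *-identityʳ _ ⟨
                   𝟙 (alive j) * 1#                                   ≈⟨ *-congˡ (𝟙-not (θ ≤ᵇ ρ * w j)) ⟨
                   𝟙 (alive j) * (𝟙 (θ ≤ᵇ ρ * w j) + 𝟙 (not (θ ≤ᵇ ρ * w j))) ≈⟨ distribˡ _ _ _ ⟩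
                   _                                                  ≈⟨ +-congˡ (𝟙-∧ (alive j) _) ⟨
                   𝟙 (alive j) * 𝟙 (θ ≤ᵇ ρ * w j) + 𝟙 (low θ alive w j) ∎) ⟩
            sum (λ j → 𝟙 (alive j) * 𝟙 (θ ≤ᵇ ρ * w j) + 𝟙 (low θ alive w j)) ≈⟨ sum-+ {k} _ _ ⟩
            A + Q ∎

          -- A - P clusters lie in the gap between the two classes. Since S (P + Q) = P, they alone
          -- contribute the extra (A - P) S, and 0 ≤ S ≤ 1 then places u S between P and A.
          uS≈ : u * S ≈ P + (A - P) * S
          uS≈ = begin-equality
            u * S                          ≈⟨ *-congʳ u≈A+Q ⟩
            (A + Q) * S                    ≈⟨ solve 4 (λ A P Q S → (A :+ Q) :* S := S :* (P :+ Q) :+ (A :- P) :* S) refl A P Q S ⟩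
            S * (P + Q) + (A - P) * S      ≈⟨ +-congʳ (ratio*total (0≤count (high θ alive w)) (0≤count (low θ alive w))) ⟩
            P + (A - P) * S                ∎

          survival-lower : P ≤ u * S
          survival-lower = ≤-slack (*-nonNeg (x≤y⇒0≤y-x P≤A) (0≤survival θ alive w)) uS≈

          survival-upper : u * S ≤ A
          survival-upper = begin
            u * S               ≈⟨ uS≈ ⟩
            P + (A - P) * S     ≤⟨ +-monoʳ-≤ P (*-monoʳ-≤ (x≤y⇒0≤y-x P≤A) (ratio≤1 (0≤count (high θ alive w)) (0≤count (low θ alive w)))) ⟩
            P + (A - P) * 1#    ≈⟨ solve 2 (λ A P → P :+ (A :- P) :* con (pos 1) := A) refl A P ⟩
            A                   ∎

        layered : ∀ (x : Fin k → Carrier) →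
          sum (λ l → Δ l * sum (λ j → 𝟙 (alive j) * 𝟙 (θ l ≤ᵇ x j)))
            ≈ sum (λ j → 𝟙 (alive j) * sum (λ l → Δ l * 𝟙 (θ l ≤ᵇ x j)))
        layered x = begin-equality
          sum (λ l → Δ l * sum (λ j → 𝟙 (alive j) * 𝟙 (θ l ≤ᵇ x j)))
            ≈⟨ sum-cong {size} (λ l → *-sum {k} (Δ l) _) ⟨
          sum (λ l → sum (λ j → Δ l * (𝟙 (alive j) * 𝟙 (θ l ≤ᵇ x j))))
            ≈⟨ sum-swap {size} {k} _ ⟩
          sum (λ j → sum (λ l → Δ l * (𝟙 (alive j) * 𝟙 (θ l ≤ᵇ x j))))
            ≈⟨ sum-cong {k} (λ j → sum-cong {size} (λ l →
                 solve 3 (λ Δ a b → Δ :* (a :* b) := a :* (Δ :* b)) refl (Δ l) (𝟙 (alive j)) _)) ⟩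
          sum (λ j → sum (λ l → 𝟙 (alive j) * (Δ l * 𝟙 (θ l ≤ᵇ x j))))
            ≈⟨ sum-cong {k} (λ j → *-sum {size} (𝟙 (alive j)) _) ⟩
          sum (λ j → 𝟙 (alive j) * sum (λ l → Δ l * 𝟙 (θ l ≤ᵇ x j))) ∎

        uG≈ : u * G alive w ≈ sum (λ l → Δ l * (u * survival (θ l) alive w))
        uG≈ = trans (sym (*-sum {size} u _)) (sum-cong {size} (λ l →
          solve 3 (λ u Δ S → u :* (Δ :* S) := Δ :* (u :* S)) refl u (Δ l) _))

        -- At each level u S is at most the number of unhit clusters with θ ≤ ρ w, and integrating
        -- over the levels counts each such cluster at most ρ w.
        G-upper : u * G alive w ≤ ρ * sum (λ j → 𝟙 (alive j) * w j)
        G-upper = begin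
          u * G alive w
            ≈⟨ uG≈ ⟩
          sum (λ l → Δ l * (u * survival (θ l) alive w))
            ≤⟨ sum-mono {size} (λ l → *-monoʳ-≤ (0≤Δ l) (survival-upper (θ l))) ⟩
          sum (λ l → Δ l * sum (λ j → 𝟙 (alive j) * 𝟙 (θ l ≤ᵇ ρ * w j)))
            ≈⟨ layered (λ j → ρ * w j) ⟩
          sum (λ j → 𝟙 (alive j) * sum (λ l → Δ l * 𝟙 (θ l ≤ᵇ ρ * w j)))
            ≤⟨ sum-mono {k} (λ j → *-monoʳ-≤ (0≤𝟙 (alive j))
                 (≤-trans (≤-reflexive (sym (+-identityˡ _))) (below (*-nonNeg 0≤ρ (0≤w j))))) ⟩
          sum (λ j → 𝟙 (alive j) * (ρ * w j))
            ≈⟨ sum-cong {k} (λ j → solve 3 (λ a ρ w → a :* (ρ :* w) := ρ :* (a :* w)) refl (𝟙 (alive j)) ρ (w j)) ⟩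
          sum (λ j → ρ * (𝟙 (alive j) * w j))
            ≈⟨ *-sum {k} ρ _ ⟩
          ρ * sum (λ j → 𝟙 (alive j) * w j) ∎

        -- At each level u S is at least the number of high clusters. Integrating recovers each cost
        -- w in full because it is one of the values for which the layers are exact.
        G-lower : (∀ j → w j ∈ V) → sum (λ j → 𝟙 (alive j) * w j) ≤ u * G alive w
        G-lower w∈V = begin
          sum (λ j → 𝟙 (alive j) * w j)
            ≤⟨ sum-mono {k} (λ j → *-monoʳ-≤ (0≤𝟙 (alive j)) (≤-trans (above (w∈V j)) (≤-reflexive (+-identityˡ _)))) ⟩
          sum (λ j → 𝟙 (alive j) * sum (λ l → Δ l * 𝟙 (θ l ≤ᵇ w j)))
            ≈⟨ layered w ⟨
          sum (λ l → Δ l * sum (λ j → 𝟙 (alive j) * 𝟙 (θ l ≤ᵇ w j)))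
            ≈⟨ sum-cong {size} (λ l → *-congˡ (sum-cong {k} (λ j → 𝟙-∧ (alive j) _))) ⟨
          sum (λ l → Δ l * count (high (θ l) alive w))
            ≤⟨ sum-mono {size} (λ l → *-monoʳ-≤ (0≤Δ l) (survival-lower (θ l))) ⟩
          sum (λ l → Δ l * (u * survival (θ l) alive w))
            ≈⟨ uG≈ ⟨
          u * G alive w ∎

      module _ {n} (σ : Fin n → Fin k) {q D : Fin n → Carrier} {α : Carrier}
               (0≤q : ∀ i → 0# ≤ q i) (Σq≈1 : sum q ≈ 1#) (0≤D : ∀ i → 0# ≤ D i) (0≤α : 0# ≤ α)
               (αD≤q : ∀ i → α * D i ≤ q i) (q≤ραD : ∀ i → q i ≤ ρ * (α * D i)) where

        open Step σ 0≤q Σq≈1 0≤D 0≤α αD≤q q≤ραD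

        -- Levels and masses do not depend on the sample, so the property passes from the single
        -- levels to their weighted sum.
        G-supermartingale : ∀ alive {w′ : Fin n → Fin k → Carrier} → (∀ i l → w′ i l ≤ fibre σ D l) →
          sum (λ i → q i * G (remove alive (σ i)) (w′ i)) ≤ G alive (fibre σ D)
        G-supermartingale alive {w′} w′≤w = begin
          sum (λ i → q i * G (remove alive (σ i)) (w′ i))
            ≈⟨ sum-cong {n} (λ i → *-sum {size} (q i) _) ⟨
          sum (λ i → sum (λ l → q i * (Δ l * survival (θ l) (remove alive (σ i)) (w′ i))))
            ≈⟨ sum-swap {n} {size} _ ⟩
          sum (λ l → sum (λ i → q i * (Δ l * survival (θ l) (remove alive (σ i)) (w′ i))))
            ≈⟨ sum-cong {size} (λ l → trans (sum-cong {n} (λ i →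
                 solve 3 (λ q Δ S → q :* (Δ :* S) := Δ :* (q :* S)) refl (q i) (Δ l) _)) (*-sum {n} (Δ l) _)) ⟩
          sum (λ l → Δ l * sum (λ i → q i * survival (θ l) (remove alive (σ i)) (w′ i)))
            ≤⟨ sum-mono {size} (λ l → *-monoʳ-≤ (0≤Δ l) (survival-supermartingale (θ l) alive w′≤w)) ⟩
          G alive (fibre σ D) ∎

  open Min totalOrder using (x⊓y≤x; x⊓y≤y; ⊓-sel)

  -- Squared distances

  0≤‖‖² : ∀ {d} (x y : Point d) → 0# ≤ ‖ x - y ‖²
  0≤‖‖² x y = 0≤sum _ (λ t → 0≤x² (x t - y t))

  φ₁-lower : ∀ {d} (x : Point d) C j → φ₁ x C ≤ ‖ x - List.lookup (List⁺.toList C) j ‖²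
  φ₁-lower x (c ∷ C) j = go c C j
    where
    go : ∀ c C j → φ₁ x (c ∷ C) ≤ ‖ x - List.lookup (c List.∷ C) j ‖²
    go c List.[]        Fin.zero    = ≤-refl
    go c (c′ List.∷ C) Fin.zero    = x⊓y≤x _ _
    go c (c′ List.∷ C) (Fin.suc j) = ≤-trans (x⊓y≤y ‖ x - c ‖² _) (go c′ C j)

  φ₁-attained : ∀ {d} (x : Point d) C → ∃ λ j → ‖ x - List.lookup (List⁺.toList C) j ‖² ≤ φ₁ x C
  φ₁-attained x (c ∷ C) = go c C
    where
    go : ∀ c C → ∃ λ j → ‖ x - List.lookup (c List.∷ C) j ‖² ≤ φ₁ x (c ∷ C)
    go c List.[] = Fin.zero , ≤-refl
    go c (c′ List.∷ C) with ⊓-sel ‖ x - c ‖² (φ₁ x (c′ ∷ C)) | go c′ C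
    ... | inj₁ eq | _      = Fin.zero , ≤-reflexive (sym eq)
    ... | inj₂ eq | j , le = Fin.suc j , ≤-trans le (≤-reflexive (sym eq))

  φ₁-∷⁺ : ∀ {d} (x c : Point d) C → φ₁ x (c ∷⁺ C) ≤ φ₁ x C × φ₁ x (c ∷⁺ C) ≤ ‖ x - c ‖²
  φ₁-∷⁺ x c C = x⊓y≤y ‖ x - c ‖² _ , x⊓y≤x _ _

  -- In each coordinate this is 2 (a² + b²) = (a - b)² + (a + b)² with a = y - c and b = y - x, the
  -- last square being dropped.
  ‖‖²-quasitriangle : ∀ {d} (x y c : Point d) → ‖ x - c ‖² ≤ fromℕ 2 * (‖ y - c ‖² + ‖ y - x ‖²)
  ‖‖²-quasitriangle {d} x y c = begin
    ‖ x - c ‖²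
      ≤⟨ sum-mono {d} (λ t → ≤-slack (0≤x² ((y t - c t) + (y t - x t)))
           (solve 3 (λ x y c → con (pos 2) :* ((y :- c) :^ 2 :+ (y :- x) :^ 2)
              := (x :- c) :^ 2 :+ ((y :- c) :+ (y :- x)) :^ 2) refl (x t) (y t) (c t))) ⟩
    sum (λ t → fromℕ 2 * ((y t - c t) ^ 2 + (y t - x t) ^ 2))
      ≈⟨ trans (*-sum {d} _ _) (*-congˡ (sum-+ {d} _ _)) ⟩
    fromℕ 2 * (‖ y - c ‖² + ‖ y - x ‖²) ∎

  -- Both points are compared with the center nearest to `y`.
  φ₁-quasitriangle : ∀ {d} (x y : Point d) C → φ₁ x C ≤ fromℕ 2 * (φ₁ y C + ‖ y - x ‖²)
  φ₁-quasitriangle x y C with φ₁-attained y C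
  ... | j , attained = begin
    φ₁ x C                                        ≤⟨ φ₁-lower x C j ⟩
    ‖ x - c ‖²                                    ≤⟨ ‖‖²-quasitriangle x y c ⟩
    fromℕ 2 * (‖ y - c ‖² + ‖ y - x ‖²)           ≤⟨ *-monoʳ-≤ (0≤fromℕ 2) (+-monoˡ-≤ _ attained) ⟩
    fromℕ 2 * (φ₁ y C + ‖ y - x ‖²)               ∎
    where c = List.lookup (List⁺.toList C) j

  weighted-swap : ∀ {m d} (e : Fin m → Carrier) (g : Fin m → Fin d → Carrier) →
    sum (λ a → e a * sum (g a)) ≈ sum (λ t → sum (λ a → e a * g a t))
  weighted-swap {m} {d} e g =
    trans (sum-cong {m} (λ a → sym (*-sum {d} (e a) (g a)))) (sum-swap {m} {d} _)

  -- Squared distances split over the coordinates, and differences do not change when both points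
  -- are measured from `c`, so `pairwise-1d` applies in each coordinate.
  pairwise : ∀ {n d} (e : Fin n → Carrier) (X : Fin n → Point d) (c : Point d) → (∀ i → 0# ≤ e i) →
    sum (λ i → e i * sum (λ a → e a * ‖ X a - X i ‖²))
      ≤ fromℕ 2 * (sum e * sum (λ a → e a * ‖ X a - c ‖²))
  pairwise {n} {d} e X c 0≤e = begin
    sum (λ i → e i * sum (λ a → e a * ‖ X a - X i ‖²))
      ≈⟨ sum-cong {n} (λ i → *-congˡ (weighted-swap e (λ a t → (X a t - X i t) ^ 2))) ⟩
    sum (λ i → e i * sum (λ t → sum (λ a → e a * (X a t - X i t) ^ 2)))
      ≈⟨ weighted-swap e (λ i t → sum (λ a → e a * (X a t - X i t) ^ 2)) ⟩
    sum (λ t → sum (λ i → e i * sum (λ a → e a * (X a t - X i t) ^ 2)))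
      ≈⟨ sum-cong {d} (λ t → sum-cong {n} (λ i → *-congˡ (sum-cong {n} (λ a → *-congˡ
           (solve 3 (λ x y c → (x :- y) :^ 2 := ((x :- c) :- (y :- c)) :^ 2) refl (X a t) (X i t) (c t)))))) ⟩
    sum (λ t → sum (λ i → e i * sum (λ a → e a * ((X a t - c t) - (X i t - c t)) ^ 2)))
      ≤⟨ sum-mono {d} (λ t → pairwise-1d e (λ a → X a t - c t) 0≤e) ⟩
    sum (λ t → fromℕ 2 * (sum e * sum (λ a → e a * (X a t - c t) ^ 2)))
      ≈⟨ trans (*-sum {d} _ _) (*-congˡ (*-sum {d} _ _)) ⟩
    fromℕ 2 * (sum e * sum (λ t → sum (λ a → e a * (X a t - c t) ^ 2)))
      ≈⟨ *-congˡ (*-congˡ (weighted-swap e (λ a t → (X a t - c t) ^ 2))) ⟨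
    fromℕ 2 * (sum e * sum (λ a → e a * ‖ X a - c ‖²)) ∎

  -- The budget: cost of hit clusters plus a reserve for unhit ones

  module Covering {k : ℕ} (ρ : Carrier) (1≤ρ : 1# ≤ ρ) (cost : Fin k → Carrier) where

    open Survival {k} ρ 1≤ρ

    covered uncovered : (Fin k → Bool) → (Fin k → Carrier) → Carrier
    covered   alive w = sum (λ j → 𝟙 (not (alive j)) * w j)
    uncovered alive w = sum (λ j → 𝟙 (alive j) * w j)

    covered+uncovered : ∀ alive w → sum w ≈ covered alive w + uncovered alive w
    covered+uncovered alive w = trans (sum-cong {k} pointwise) (sum-+ {k} _ _)
      where
      pointwise : ∀ j → w j ≈ 𝟙 (not (alive j)) * w j + 𝟙 (alive j) * w j
      pointwise j with alive j
      ... | true  = sym (trans (+-cong (zeroˡ _) (*-identityˡ _)) (+-identityˡ _))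
      ... | false = sym (trans (+-cong (*-identityˡ _) (zeroˡ _)) (+-identityʳ _))

    -- An unhit cluster is charged in advance with `cost`, the bound on its expected cost once hit.
    -- Its first hit replaces the charge by the actual cost, so the budget does not grow in
    -- expectation.
    budget : (Fin k → Bool) → (Fin k → Carrier) → Carrier
    budget alive w = covered alive w + uncovered alive cost

    count-remove : ∀ alive j → count (remove alive j) + 𝟙 (alive j) ≈ count alive
    count-remove alive j = begin-equality
      count (remove alive j) + 𝟙 (alive j)
        ≈⟨ +-congˡ (sum-pick j (λ l → 𝟙 (alive l))) ⟨
      count (remove alive j) + sum (λ l → 𝟙 (j == l) * 𝟙 (alive l))
        ≈⟨ sum-+ {k} _ _ ⟨
      sum (λ l → 𝟙 (remove alive j l) + 𝟙 (j == l) * 𝟙 (alive l))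
        ≈⟨ sum-cong {k} pointwise ⟩
      count alive ∎
      where
      pointwise : ∀ l → 𝟙 (remove alive j l) + 𝟙 (j == l) * 𝟙 (alive l) ≈ 𝟙 (alive l)
      pointwise l with alive l | j == l
      ... | false | b     = trans (+-identityˡ _) (zeroʳ _)
      ... | true  | true  = trans (+-identityˡ _) (*-identityˡ _)
      ... | true  | false = trans (+-congˡ (zeroˡ _)) (+-identityʳ _)

    module _ {n} (σ : Fin n → Fin k) {q : Fin n → Carrier}
             (0≤q : ∀ i → 0# ≤ q i) (Σq≈1 : sum q ≈ 1#)
             (alive : Fin k → Bool) {w : Fin k → Carrier} {w′ : Fin n → Fin k → Carrier}
             (dead-≤ : ∀ i j → alive j ≡ false → w′ i j ≤ w j)
             (alive-≤ : ∀ j → sum (λ i → 𝟙 (σ i == j) * (q i * w′ i j))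
                                ≤ cost j * sum (λ i → 𝟙 (σ i == j) * q i)) where

      private
        gain : Fin n → Fin k → Carrier
        gain i j = 𝟙 (σ i == j) * (𝟙 (alive j) * (w′ i j - cost j))

      -- Clusters hit earlier only become cheaper, and sampling `i` exchanges the charge of its own
      -- cluster, if still unhit, for the new cost. The difference is the `gain`.
      budget-remove : ∀ i → budget (remove alive (σ i)) (w′ i) ≤ budget alive w + sum (gain i)
      budget-remove i = begin
        budget (remove alive (σ i)) (w′ i)
          ≈⟨ sum-+ {k} _ _ ⟨
        sum (λ j → 𝟙 (not (remove alive (σ i) j)) * w′ i j + 𝟙 (remove alive (σ i) j) * cost j)
          ≤⟨ sum-mono {k} pointwise ⟩
        sum (λ j → (𝟙 (not (alive j)) * w j + 𝟙 (alive j) * cost j) + gain i j)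
          ≈⟨ trans (sum-+ {k} _ _) (+-congʳ (sum-+ {k} _ _)) ⟩
        budget alive w + sum (gain i) ∎
        where
        pointwise : ∀ j → 𝟙 (not (remove alive (σ i) j)) * w′ i j + 𝟙 (remove alive (σ i) j) * cost j
                        ≤ (𝟙 (not (alive j)) * w j + 𝟙 (alive j) * cost j) + gain i j
        pointwise j with alive j in alive-j | σ i == j
        ... | false | b     = ≤-trans (+-monoˡ-≤ _ (*-monoʳ-≤ 0≤1 (dead-≤ i j alive-j)))
          (≤-reflexive (solve 4 (λ w c b x → con (pos 1) :* w :+ con (pos 0) :* c
              := (con (pos 1) :* w :+ con (pos 0) :* c) :+ b :* (con (pos 0) :* x)) refl (w j) (cost j) (𝟙 b) _))
        ... | true  | true  = ≤-reflexive (solve 3 (λ w w′ c → con (pos 1) :* w′ :+ con (pos 0) :* c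
              := (con (pos 0) :* w :+ con (pos 1) :* c) :+ con (pos 1) :* (con (pos 1) :* (w′ :- c)))
              refl (w j) (w′ i j) (cost j))
        ... | true  | false = ≤-reflexive (solve 4 (λ w w′ c x → con (pos 0) :* w′ :+ con (pos 1) :* c
              := (con (pos 0) :* w :+ con (pos 1) :* c) :+ con (pos 0) :* x)
              refl (w j) (w′ i j) (cost j) _)

      -- `alive-≤` bounds the expected new cost on the event of hitting a cluster by `cost` times
      -- the probability of that event, so the gains within each unhit cluster sum to at most zero.
      expected-gain : sum (λ i → q i * sum (gain i)) ≤ 0#
      expected-gain = begin
        sum (λ i → q i * sum (gain i))
          ≈⟨ sum-cong {n} (λ i → *-sum {k} (q i) _) ⟨
        sum (λ i → sum (λ j → q i * gain i j))
          ≈⟨ sum-swap {n} {k} _ ⟩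
        sum (λ j → sum (λ i → q i * gain i j))
          ≈⟨ sum-cong {k} regroup ⟩
        sum (λ j → 𝟙 (alive j) * (sum (λ i → 𝟙 (σ i == j) * (q i * w′ i j))
                                  - cost j * sum (λ i → 𝟙 (σ i == j) * q i)))
          ≤⟨ sum-mono {k} (λ j → *-monoʳ-≤ (0≤𝟙 (alive j)) (≤-slack (x≤y⇒0≤y-x (alive-≤ j))
               (solve 2 (λ x y → con (pos 0) := (x :- y) :+ (y :- x)) refl _ _))) ⟩
        sum (λ j → 𝟙 (alive j) * 0#)
          ≈⟨ sum-0 {k} (λ j → zeroʳ _) ⟩
        0# ∎
        where
        regroup : ∀ j → sum (λ i → q i * gain i j)
          ≈ 𝟙 (alive j) * (sum (λ i → 𝟙 (σ i == j) * (q i * w′ i j))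
                           - cost j * sum (λ i → 𝟙 (σ i == j) * q i))
        regroup j = begin-equality
          sum (λ i → q i * gain i j)
            ≈⟨ sum-cong {n} (λ i → solve 5 (λ q b a w c → q :* (b :* (a :* (w :- c)))
                 := a :* (b :* (q :* w)) :+ (:- (a :* c)) :* (b :* q)) refl (q i) (𝟙 (σ i == j)) (𝟙 (alive j)) (w′ i j) (cost j)) ⟩
          sum (λ i → 𝟙 (alive j) * (𝟙 (σ i == j) * (q i * w′ i j)) + - (𝟙 (alive j) * cost j) * (𝟙 (σ i == j) * q i))
            ≈⟨ sum-linear {n} _ _ _ _ ⟩
          𝟙 (alive j) * W + - (𝟙 (alive j) * cost j) * Q
            ≈⟨ solve 4 (λ a c w q → a :* w :+ (:- (a :* c)) :* q := a :* (w :- c :* q)) refl (𝟙 (alive j)) (cost j) W Q ⟩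
          𝟙 (alive j) * (W - cost j * Q) ∎
          where
          W = sum (λ i → 𝟙 (σ i == j) * (q i * w′ i j))
          Q = sum (λ i → 𝟙 (σ i == j) * q i)

      budget-supermartingale : sum (λ i → q i * budget (remove alive (σ i)) (w′ i)) ≤ budget alive w
      budget-supermartingale = begin
        sum (λ i → q i * budget (remove alive (σ i)) (w′ i))
          ≤⟨ sum-mono {n} (λ i → *-monoʳ-≤ (0≤q i) (budget-remove i)) ⟩
        sum (λ i → q i * (budget alive w + sum (gain i)))
          ≈⟨ sum-cong {n} (λ i → solve 3 (λ q b g → q :* (b :+ g) := b :* q :+ q :* g) refl (q i) _ _) ⟩
        sum (λ i → budget alive w * q i + q i * sum (gain i))
          ≈⟨ trans (sum-+ {n} _ _) (+-congʳ (trans (*-sum {n} _ _) (trans (*-congˡ Σq≈1) (*-identityʳ _)))) ⟩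
        budget alive w + sum (λ i → q i * sum (gain i))
          ≤⟨ +-monoʳ-≤ _ expected-gain ⟩
        budget alive w + 0#
          ≈⟨ +-identityʳ _ ⟩
        budget alive w ∎

  -- Harmonic numbers and the logarithm

  0<fromℕ : ∀ n → 0# < fromℕ (suc n)
  0<fromℕ n = <-≤-trans 0<1 (1≤fromℕ {suc n} (ℕ.s≤s ℕ.z≤n))

  harmonic : ℕ → Carrier
  harmonic zero    = 0#
  harmonic (suc n) = harmonic n + 1# / fromℕ (suc n)

  0≤1/fromℕ : ∀ n → 0# ≤ 1# / fromℕ (suc n)
  0≤1/fromℕ n = *-nonNeg 0≤1 (proj₁ (⁻¹-pos (0<fromℕ n)))

  0≤harmonic : ∀ n → 0# ≤ harmonic n
  0≤harmonic zero    = ≤-refl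
  0≤harmonic (suc n) = +-nonNeg (0≤harmonic n) (0≤1/fromℕ n)

  -- Addition in accumulator form: successors move to the second argument just as `unit-steps`
  -- advances its left endpoint, so the types agree by computation.
  shift : ℕ → ℕ → ℕ
  shift zero    a = a
  shift (suc m) a = shift m (suc a)

  shift≡+ : ∀ m a → shift m a ≡ m ℕ.+ a
  shift≡+ zero    a = ≡.refl
  shift≡+ (suc m) a = ≡.trans (shift≡+ m (suc a)) (ℕ.+-suc m a)

  unit-steps : ∀ m a → Partition (fromℕ (suc a)) (fromℕ (suc (shift m a)))
  unit-steps zero    a = end _
  unit-steps (suc m) a = step (≤-slack 0≤1 (+-comm _ _)) (unit-steps m (suc a))

  -- The interval from x to x + 1 contributes 1 / (x + 1) to the lower sum, which is the next
  -- harmonic term.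
  harmonic-lowerSum : ∀ m a →
    harmonic (suc a) + lowerSum (unit-steps m a) ≈ harmonic (suc (shift m a))
  harmonic-lowerSum zero    a = +-identityʳ _
  harmonic-lowerSum (suc m) a = begin-equality
    harmonic (suc a) + ((x′ - x) / x′ + lowerSum (unit-steps m (suc a)))
      ≈⟨ +-assoc _ _ _ ⟨
    harmonic (suc a) + (x′ - x) / x′ + lowerSum (unit-steps m (suc a))
      ≈⟨ +-congʳ (+-congˡ (*-congʳ (solve 1 (λ x → (con (pos 1) :+ x) :- x := con (pos 1)) refl x))) ⟩
    harmonic (suc (suc a)) + lowerSum (unit-steps m (suc a))
      ≈⟨ harmonic-lowerSum m (suc a) ⟩
    harmonic (suc (shift m (suc a))) ∎
    where
    x  = fromℕ (suc a)
    x′ = fromℕ (suc (suc a))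

  0≤ln : ∀ {x} (1≤x : 1# ≤ x) → 0# ≤ ln x 1≤x
  0≤ln {x} 1≤x = ≤-trans
    (+-nonNeg (*-nonNeg (x≤y⇒0≤y-x 1≤x) (proj₁ (⁻¹-pos (<-≤-trans 0<1 1≤x)))) ≤-refl)
    (proj₁ (proj₂ (ln-supremum x 1≤x)) (step 1≤x (end x) , refl))

  -- The harmonic number of m + 1 exceeds its first term by the lower sum with unit steps from 1 to
  -- m + 1, and `ln` is the supremum of such lower sums.
  harmonic≤1+ln : ∀ m (1≤m : 1# ≤ fromℕ (suc m)) → harmonic m ≤ 1# + ln (fromℕ (suc m)) 1≤m
  harmonic≤1+ln m = ≡.subst (λ l → ∀ (1≤l : 1# ≤ fromℕ (suc l)) → harmonic l ≤ 1# + ln (fromℕ (suc l)) 1≤l)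
    (≡.trans (shift≡+ m 0) (ℕ.+-identityʳ m)) shifted
    where
    shifted : (1≤l : 1# ≤ fromℕ (suc (shift m 0))) →
              harmonic (shift m 0) ≤ 1# + ln (fromℕ (suc (shift m 0))) 1≤l
    shifted 1≤l = begin
      harmonic (shift m 0)                          ≤⟨ ≤-slack (0≤1/fromℕ (shift m 0)) refl ⟩
      harmonic (suc (shift m 0))                    ≈⟨ harmonic-lowerSum m 0 ⟨
      harmonic 1 + lowerSum (unit-steps m 0)        ≤⟨ +-mono-≤ harmonic1≤1 lowerSum≤ln ⟩
      1# + ln (fromℕ (suc (shift m 0))) 1≤l         ∎
      where
      1≤1 : 1# ≤ fromℕ 1
      1≤1 = 1≤fromℕ {1} (ℕ.s≤s ℕ.z≤n)

      harmonic1≤1 : harmonic 1 ≤ 1#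
      harmonic1≤1 = begin
        0# + 1# / fromℕ 1  ≈⟨ trans (+-identityˡ _) (*-identityˡ _) ⟩
        fromℕ 1 ⁻¹         ≤⟨ 1≤x⇒x⁻¹≤1 1≤1 ⟩
        1#                 ∎

      -- Partitions for `ln` start at `1#`, whereas `unit-steps` starts at `fromℕ 1`, which is
      -- `1# + 0#`. A step of length zero joins the two.
      lowerSum≤ln : lowerSum (unit-steps m 0) ≤ ln (fromℕ (suc (shift m 0))) 1≤l
      lowerSum≤ln = begin
        lowerSum (unit-steps m 0)
          ≤⟨ ≤-slack (*-nonNeg (x≤y⇒0≤y-x 1≤1) (proj₁ (⁻¹-pos (0<fromℕ 0)))) (+-comm _ _) ⟩
        lowerSum (step 1≤1 (unit-steps m 0))
          ≤⟨ proj₁ (proj₂ (ln-supremum _ 1≤l)) (step 1≤1 (unit-steps m 0) , refl) ⟩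
        ln (fromℕ (suc (shift m 0))) 1≤l ∎

  -- One round of the combined potential

  module Round {k : ℕ} (ρ : Carrier) (1≤ρ : 1# ≤ ρ) (cost : Fin k → Carrier) (0≤cost : ∀ j → 0# ≤ cost j)
               {V : List Carrier} (cake : Layers 0# V) where

    open Survival {k} ρ 1≤ρ
    open Potential cake
    open Covering ρ 1≤ρ cost

    module _ {n} (σ : Fin n → Fin k) {q D : Fin n → Carrier} {α : Carrier}
             (0≤q : ∀ i → 0# ≤ q i) (Σq≈1 : sum q ≈ 1#) (0≤D : ∀ i → 0# ≤ D i) (0≤α : 0# ≤ α)
             (αD≤q : ∀ i → α * D i ≤ q i) (q≤ραD : ∀ i → q i ≤ ρ * (α * D i)) (αΦ≤1 : α * sum D ≤ 1#)
             (alive : Fin k → Bool) {w′ : Fin n → Fin k → Carrier}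
             (w′≤w : ∀ i j → w′ i j ≤ fibre σ D j)
             (alive-≤ : ∀ j → sum (λ i → 𝟙 (σ i == j) * (q i * w′ i j))
                                ≤ cost j * sum (λ i → 𝟙 (σ i == j) * q i)) where

      private
        w = fibre σ D
        u = count alive
        B = budget alive w
        g = G alive w
        hit = sum (λ i → 𝟙 (not (alive (σ i))) * q i)

      0≤w : ∀ j → 0# ≤ w j
      0≤w j = 0≤sum _ (λ i → *-nonNeg (0≤𝟙 (σ i == j)) (0≤D i))

      Φ≈ : sum D ≈ covered alive w + uncovered alive w
      Φ≈ = begin-equality
        sum D                    ≈⟨ sum-cong {n} (λ i → *-identityˡ (D i)) ⟨
        sum (λ i → 1# * D i)     ≈⟨ sum-fibres σ (λ _ → 1#) D ⟩
        sum (λ j → 1# * w j)     ≈⟨ sum-cong {k} (λ j → *-identityˡ (w j)) ⟩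
        sum w                    ≈⟨ covered+uncovered alive w ⟩
        covered alive w + uncovered alive w ∎

      0≤covered : 0# ≤ covered alive w
      0≤covered = 0≤sum _ (λ j → *-nonNeg (0≤𝟙 (not (alive j))) (0≤w j))

      covered≤B : covered alive w ≤ B
      covered≤B = ≤-slack (0≤sum _ (λ j → *-nonNeg (0≤𝟙 (alive j)) (0≤cost j))) refl

      0≤B : 0# ≤ B
      0≤B = ≤-trans 0≤covered covered≤B

      hit≤ : hit ≤ ρ * (α * B)
      hit≤ = begin
        hit
          ≤⟨ sum-mono {n} (λ i → ≤-trans (*-monoʳ-≤ (0≤𝟙 (not (alive (σ i)))) (q≤ραD i))
               (≤-reflexive (solve 4 (λ b ρ α D → b :* (ρ :* (α :* D)) := ρ :* (α :* (b :* D))) refl _ ρ α (D i)))) ⟩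
        sum (λ i → ρ * (α * (𝟙 (not (alive (σ i))) * D i)))
          ≈⟨ trans (*-sum {n} ρ _) (*-congˡ (*-sum {n} α _)) ⟩
        ρ * (α * sum (λ i → 𝟙 (not (alive (σ i))) * D i))
          ≈⟨ *-congˡ (*-congˡ (sum-fibres σ (λ j → 𝟙 (not (alive j))) D)) ⟩
        ρ * (α * covered alive w)
          ≤⟨ *-monoʳ-≤ 0≤ρ (*-monoʳ-≤ 0≤α covered≤B) ⟩
        ρ * (α * B) ∎

      -- The expected loss through sampling a cluster hit before: (r + 1) g ≤ u g ≤ ρ Φ for the
      -- total cost Φ, such a sample has probability at most ρ α B, and α Φ ≤ 1 removes Φ from the
      -- product.
      wasted : ∀ r → fromℕ (suc r) ≤ u → g * hit ≤ ρ * ρ * B / fromℕ (suc r)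
      wasted r r<u = x*z≤y⇒x≤y/z (0<fromℕ r) (begin
        g * hit * fromℕ (suc r)
          ≈⟨ solve 3 (λ g h r → g :* h :* r := (r :* g) :* h) refl g hit (fromℕ (suc r)) ⟩
        fromℕ (suc r) * g * hit
          ≤⟨ *-monoˡ-≤ 0≤hit (*-monoˡ-≤ (0≤G alive w) r<u) ⟩
        u * g * hit
          ≤⟨ *-monoˡ-≤ 0≤hit (G-upper alive 0≤w) ⟩
        ρ * uncovered alive w * hit
          ≤⟨ *-monoˡ-≤ 0≤hit (*-monoʳ-≤ 0≤ρ (≤-slack 0≤covered (trans Φ≈ (+-comm _ _)))) ⟩
        ρ * sum D * hit
          ≤⟨ *-monoʳ-≤ (*-nonNeg 0≤ρ (0≤sum _ 0≤D)) hit≤ ⟩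
        ρ * sum D * (ρ * (α * B))
          ≈⟨ solve 4 (λ ρ Φ α B → ρ :* Φ :* (ρ :* (α :* B)) := ρ :* ρ :* B :* (α :* Φ)) refl ρ (sum D) α B ⟩
        ρ * ρ * B * (α * sum D)
          ≤⟨ *-monoʳ-≤ (*-nonNeg (*-nonNeg 0≤ρ 0≤ρ) 0≤B) αΦ≤1 ⟩
        ρ * ρ * B * 1#
          ≈⟨ *-identityʳ _ ⟩
        ρ * ρ * B ∎)
        where
        0≤hit : 0# ≤ hit
        0≤hit = 0≤sum _ (λ i → *-nonNeg (0≤𝟙 (not (alive (σ i)))) (0≤q i))

      -- A new hit lowers the unhit clusters and the remaining rounds together, leaving the
      -- coefficient v of G unchanged. A wasted round raises it by one, at the price bounded in
      -- `wasted`. Apart from that, c and v are nonnegative constants, so both supermartingales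
      -- apply.
      round : ∀ r {c} → 0# ≤ c → fromℕ (suc r) ≤ u →
        sum (λ i → q i * (c * budget (remove alive (σ i)) (w′ i)
                          + (count (remove alive (σ i)) - fromℕ r) * G (remove alive (σ i)) (w′ i)))
          ≤ (c + ρ * ρ * (1# / fromℕ (suc r))) * B + (u - fromℕ (suc r)) * g
      round r {c} 0≤c r<u = begin
        sum (λ i → q i * (c * B′ i + (u′ i - fromℕ r) * g′ i))
          ≤⟨ sum-mono {n} pointwise ⟩
        sum (λ i → c * (q i * B′ i) + v * (q i * g′ i) + g * (𝟙 (not (alive (σ i))) * q i))
          ≈⟨ trans (sum-+ {n} _ _) (+-cong (sum-linear {n} c v _ _) (*-sum {n} g _)) ⟩
        c * sum (λ i → q i * B′ i) + v * sum (λ i → q i * g′ i) + g * hit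
          ≤⟨ +-mono-≤ (+-mono-≤
               (*-monoʳ-≤ 0≤c (budget-supermartingale σ 0≤q Σq≈1 alive (λ i j _ → w′≤w i j) alive-≤))
               (*-monoʳ-≤ (x≤y⇒0≤y-x r<u) (G-supermartingale σ 0≤q Σq≈1 0≤D 0≤α αD≤q q≤ραD alive w′≤w)))
               (wasted r r<u) ⟩
        c * B + v * g + ρ * ρ * B / fromℕ (suc r)
          ≈⟨ solve 6 (λ c B v g ρ t → c :* B :+ v :* g :+ ρ :* ρ :* B :* t
               := (c :+ ρ :* ρ :* (con (pos 1) :* t)) :* B :+ v :* g) refl c B v g ρ (fromℕ (suc r) ⁻¹) ⟩
        (c + ρ * ρ * (1# / fromℕ (suc r))) * B + v * g ∎
        where
        v = u - fromℕ (suc r)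
        u′ B′ g′ : Fin n → Carrier
        u′ i = count (remove alive (σ i))
        B′ i = budget (remove alive (σ i)) (w′ i)
        g′ i = G (remove alive (σ i)) (w′ i)

        remaining : ∀ i → u′ i - fromℕ r ≈ v + 𝟙 (not (alive (σ i)))
        remaining i = begin-equality
          u′ i - fromℕ r
            ≈⟨ solve 4 (λ u r a b → u :- r := ((u :+ a) :- ((a :+ b) :+ r)) :+ b) refl (u′ i) (fromℕ r) (𝟙 a) (𝟙 (not a)) ⟩
          (u′ i + 𝟙 a) - ((𝟙 a + 𝟙 (not a)) + fromℕ r) + 𝟙 (not a)
            ≈⟨ +-congʳ (+-cong (count-remove alive (σ i)) (-‿cong (+-congʳ (𝟙-not a)))) ⟩
          v + 𝟙 (not a) ∎
          where a = alive (σ i)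

        -- The bound for each single outcome is what lets the extra term of wasted rounds factor as
        -- `g` times `hit`.
        dead-G : ∀ i → 𝟙 (not (alive (σ i))) * g′ i ≤ 𝟙 (not (alive (σ i))) * g
        dead-G i with alive (σ i) in dead
        ... | true  = ≤-reflexive (trans (zeroˡ _) (sym (zeroˡ _)))
        ... | false = *-monoʳ-≤ 0≤1 (G-dead alive 0≤w (σ i) dead (w′≤w i))

        pointwise : ∀ i → q i * (c * B′ i + (u′ i - fromℕ r) * g′ i)
          ≤ c * (q i * B′ i) + v * (q i * g′ i) + g * (𝟙 (not (alive (σ i))) * q i)
        pointwise i = begin
          q i * (c * B′ i + (u′ i - fromℕ r) * g′ i)
            ≈⟨ *-congˡ (+-congˡ (trans (*-congʳ (remaining i)) (distribʳ _ _ _))) ⟩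
          q i * (c * B′ i + (v * g′ i + 𝟙 (not (alive (σ i))) * g′ i))
            ≤⟨ *-monoʳ-≤ (0≤q i) (+-monoʳ-≤ _ (+-monoʳ-≤ _ (dead-G i))) ⟩
          q i * (c * B′ i + (v * g′ i + 𝟙 (not (alive (σ i))) * g))
            ≈⟨ solve 7 (λ q c B v g′ b g → q :* (c :* B :+ (v :* g′ :+ b :* g))
                 := c :* (q :* B) :+ v :* (q :* g′) :+ g :* (b :* q)) refl (q i) c (B′ i) v (g′ i) _ g ⟩
          c * (q i * B′ i) + v * (q i * g′ i) + g * (𝟙 (not (alive (σ i))) * q i) ∎

    -- With no rounds left, `G-lower` pays for the clusters never hit. The factors 1 and the
    -- difference with 0 match the combined potential at r = 0.
    terminal : ∀ alive {w} → (∀ j → w j ∈ V) → (∀ j → 0# ≤ w j) →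
           sum w ≤ 1# * budget alive w + (count alive - 0#) * G alive w
    terminal alive {w} w∈V 0≤w = begin
      sum w
        ≈⟨ covered+uncovered alive w ⟩
      covered alive w + uncovered alive w
        ≤⟨ +-mono-≤ (≤-slack (0≤sum _ (λ j → *-nonNeg (0≤𝟙 (alive j)) (0≤cost j))) refl) (G-lower alive 0≤w w∈V) ⟩
      budget alive w + count alive * G alive w
        ≈⟨ solve 3 (λ b u g → b :+ u :* g := con (pos 1) :* b :+ (u :- con (pos 0)) :* g) refl _ _ _ ⟩
      1# * budget alive w + (count alive - 0#) * G alive w ∎

  -- The noise factor ρ and its linear bound

  module Noise (ε : Carrier) (0≤ε : 0# ≤ ε) (ε<1 : ε < 1#) where

    ρ : Carrier
    ρ = (1# + ε) / (1# - ε)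

    0<1-ε : 0# < 1# - ε
    0<1-ε = x≤y⇒0≤y-x (proj₁ ε<1) , λ 0≈1-ε → proj₂ ε<1 (begin-equality
      ε                ≈⟨ +-identityˡ ε ⟨
      0# + ε           ≈⟨ +-congʳ 0≈1-ε ⟩
      1# - ε + ε       ≈⟨ solve 1 (λ ε → con (pos 1) :- ε :+ ε := con (pos 1)) refl ε ⟩
      1#               ∎)

    1-ε≤1 : 1# - ε ≤ 1#
    1-ε≤1 = ≤-slack 0≤ε (solve 1 (λ ε → con (pos 1) := con (pos 1) :- ε :+ ε) refl ε)

    1≤ρ : 1# ≤ ρ
    1≤ρ = x*z≤y⇒x≤y/z 0<1-ε (≤-slack (+-nonNeg 0≤ε 0≤ε)
      (solve 1 (λ ε → con (pos 1) :+ ε := con (pos 1) :* (con (pos 1) :- ε) :+ (ε :+ ε)) refl ε))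

    ρ[1-ε]≈1+ε : ρ * (1# - ε) ≈ 1# + ε
    ρ[1-ε]≈1+ε = x*y/y≈x (1# + ε) 0<1-ε

    ρ⁴≤1+160ε : ε < 1# / fromℕ 2 → ρ ^ 4 ≤ 1# + fromℕ 160 * ε
    ρ⁴≤1+160ε ε<½ = *-cancelˡ-≤ 0<δ⁴ (begin
      δ ^ 4 * ρ ^ 4
        ≈⟨ solve 2 (λ δ ρ → δ :^ 4 :* ρ :^ 4 := (ρ :* δ) :^ 4) refl δ ρ ⟩
      (ρ * δ) ^ 4
        ≈⟨ ^4-cong ρ[1-ε]≈1+ε ⟩
      (1# + ε) ^ 4
        -- Both bounds agree at ε = 0 and at ε = 1/2, where they equal 81, so ε and s = 1 - 2 ε
        -- divide the difference. Written homogeneously in s and ε by means of 1 = s + 2 ε, the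
        -- quotient has nonnegative coefficients.
        ≤⟨ ≤-slack 0≤slack (solve 1 (λ ε → let s = con (pos 1) :- con (pos 2) :* ε in
             (con (pos 1) :- ε) :^ 4 :* (con (pos 1) :+ con (pos 160) :* ε)
               := (con (pos 1) :+ ε) :^ 4 :+ con (pos 8) :* (ε :* (s :* (con (pos 19) :* s :^ 3
                    :+ con (pos 72) :* (s :^ 2 :* ε) :+ con (pos 95) :* (s :* ε :^ 2) :+ con (pos 44) :* ε :^ 3)))) refl ε) ⟩
      δ ^ 4 * (1# + fromℕ 160 * ε) ∎)
      where
      δ = 1# - ε
      s = 1# - fromℕ 2 * ε

      ^4-cong : ∀ {x y} → x ≈ y → x ^ 4 ≈ y ^ 4
      ^4-cong x≈y = *-cong x≈y (*-cong x≈y (*-cong x≈y (*-cong x≈y refl)))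

      *-pos : ∀ {x y} → 0# < x → 0# < y → 0# < x * y
      *-pos {x} {y} 0<x@(0≤x , _) 0<y@(0≤y , 0≉y) = *-nonNeg 0≤x 0≤y , λ 0≈xy → 0≉y (≤-antisym 0≤y
        (*-cancelˡ-≤ 0<x (≤-reflexive (trans (sym 0≈xy) (sym (zeroʳ x))))))

      0<δ⁴ : 0# < δ ^ 4
      0<δ⁴ = *-pos 0<1-ε (*-pos 0<1-ε (*-pos 0<1-ε (*-pos 0<1-ε 0<1)))

      0<2 : 0# < fromℕ 2
      0<2 = <-≤-trans 0<1 (1≤fromℕ {2} (ℕ.s≤s ℕ.z≤n))

      0≤s : 0# ≤ s
      0≤s = x≤y⇒0≤y-x (begin
        fromℕ 2 * ε              ≤⟨ *-monoʳ-≤ (0≤fromℕ 2) (proj₁ ε<½) ⟩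
        fromℕ 2 * (1# / fromℕ 2) ≈⟨ *-comm _ _ ⟩
        1# / fromℕ 2 * fromℕ 2   ≈⟨ x*y/y≈x 1# 0<2 ⟩
        1#                       ∎)

      0≤^ : ∀ {x} → 0# ≤ x → ∀ n → 0# ≤ x ^ n
      0≤^ 0≤x zero    = 0≤1
      0≤^ 0≤x (suc n) = *-nonNeg 0≤x (0≤^ 0≤x n)

      0≤slack : 0# ≤ fromℕ 8 * (ε * (s * (fromℕ 19 * s ^ 3 + fromℕ 72 * (s ^ 2 * ε)
                                            + fromℕ 95 * (s * ε ^ 2) + fromℕ 44 * ε ^ 3)))
      0≤slack = *-nonNeg (0≤fromℕ 8) (*-nonNeg 0≤ε (*-nonNeg 0≤s (+-nonNeg (+-nonNeg (+-nonNeg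
        (*-nonNeg (0≤fromℕ 19) (0≤^ 0≤s 3))
        (*-nonNeg (0≤fromℕ 72) (*-nonNeg (0≤^ 0≤s 2) 0≤ε)))
        (*-nonNeg (0≤fromℕ 95) (*-nonNeg 0≤s (0≤^ 0≤ε 2))))
        (*-nonNeg (0≤fromℕ 44) (0≤^ 0≤ε 3)))))

  -- Expected cost relative to fixed centers and clusters

  module Analysis {n d k : ℕ} (X : Fin n → Point d)
                  (c : Fin k → Point d) (σ : Fin n → Fin k)
                  (ε : Carrier) (0≤ε : 0# ≤ ε) (ε<1 : ε < 1#)
                  {q : Adversary n} (rule : NoisyRule X k ε q) where

    open Noise ε 0≤ε ε<1
    open NoisyRule rule
    open Survival {k} ρ 1≤ρ

    O : Fin k → Carrier
    O j = sum (λ i → 𝟙 (σ i == j) * ‖ X i - c j ‖²)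

    0≤O : ∀ j → 0# ≤ O j
    0≤O j = 0≤sum _ (λ i → *-nonNeg (0≤𝟙 (σ i == j)) (0≤‖‖² (X i) (c j)))

    sum-O : sum O ≈ sum (λ i → ‖ X i - c (σ i) ‖²)
    sum-O = trans (sum-swap {k} {n} _) (sum-cong {n} (λ i → sum-pick (σ i) (λ j → ‖ X i - c j ‖²)))

    cost : Fin k → Carrier
    cost j = fromℕ 8 * ρ * O j

    0≤cost : ∀ j → 0# ≤ cost j
    0≤cost j = *-nonNeg (*-nonNeg (0≤fromℕ 8) 0≤ρ) (0≤O j)

    open Covering {k} ρ 1≤ρ cost

    D : History n → Fin n → Carrier
    D h i = φ₁ (X i) (centers X h)

    0≤D : ∀ h i → 0# ≤ D h i
    0≤D h i = φ₁-nonNeg (X i) (centers X h)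

    weight : History n → Fin k → Carrier
    weight h = fibre σ (D h)

    0≤weight : ∀ h j → 0# ≤ weight h j
    0≤weight h j = 0≤sum _ (λ i → *-nonNeg (0≤𝟙 (σ i == j)) (0≤D h i))

    weight-∷⁺ : ∀ i h j → weight (i ∷⁺ h) j ≤ weight h j
    weight-∷⁺ i h j = sum-mono {n} (λ a → *-monoʳ-≤ (0≤𝟙 (σ a == j))
      (proj₁ (φ₁-∷⁺ (X a) (X i) (centers X h))))

    -- Taking plain lists lets the recursion end at the empty history, where every cluster is unhit.
    alive : List (Fin n) → Fin k → Bool
    alive List.[]      = λ _ → true
    alive (i List.∷ h) = remove (alive h) (σ i)

    alive⁺ : History n → Fin k → Bool
    alive⁺ h = alive (List⁺.toList h)

    module FromHistory (h : History n) (h<k : List⁺.length h ℕ.< k) where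

      open IsDistribution (next-distribution h h<k) public

      Φ : Carrier
      Φ = sum (D h)

      -- If Φ vanished, then so would every sampling probability.
      0<Φ : 0# < Φ
      0<Φ = 0≤sum _ (0≤D h) , λ 0≈Φ → 0≉1 (≤-antisym 0≤1 (begin
        1#               ≈⟨ sum-one ⟨
        sum (next q h)   ≤⟨ sum-mono {n} (λ i → ≤-trans (next-upper h h<k i) (≤-reflexive (begin-equality
          (1# + ε) * (D h i * Φ ⁻¹)   ≈⟨ *-congˡ (*-congʳ (sum≈0⇒≈0 (0≤D h) (sym 0≈Φ) i)) ⟩
          (1# + ε) * (0# * Φ ⁻¹)      ≈⟨ trans (*-congˡ (zeroˡ _)) (zeroʳ _) ⟩
          0#                          ∎))) ⟩
        sum {n} (λ _ → 0#)  ≈⟨ sum-0 {n} (λ _ → refl) ⟩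
        0#                  ∎))

      α : Carrier
      α = (1# - ε) / Φ

      0≤α : 0# ≤ α
      0≤α = *-nonNeg (proj₁ 0<1-ε) (proj₁ (⁻¹-pos 0<Φ))

      αΦ≤1 : α * Φ ≤ 1#
      αΦ≤1 = ≤-trans (≤-reflexive (x*y/y≈x (1# - ε) 0<Φ)) 1-ε≤1

      αD≤q : ∀ i → α * D h i ≤ next q h i
      αD≤q i = ≤-trans (≤-reflexive (solve 3 (λ δ Φ D → δ :* Φ :* D := δ :* (D :* Φ)) refl (1# - ε) (Φ ⁻¹) (D h i)))
                       (next-lower h h<k i)

      q≤ραD : ∀ i → next q h i ≤ ρ * (α * D h i)
      q≤ραD i = ≤-trans (next-upper h h<k i) (≤-reflexive (begin-equality
        (1# + ε) * (D h i * Φ ⁻¹)       ≈⟨ *-congʳ ρ[1-ε]≈1+ε ⟨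
        ρ * (1# - ε) * (D h i * Φ ⁻¹)   ≈⟨ solve 4 (λ ρ δ Φ D → ρ :* δ :* (D :* Φ) := ρ :* (δ :* Φ :* D)) refl ρ (1# - ε) (Φ ⁻¹) (D h i) ⟩
        ρ * (α * D h i)                 ∎))

      expected-weight : ∀ j → sum (λ i → 𝟙 (σ i == j) * (next q h i * weight (i ∷⁺ h) j))
                                ≤ cost j * sum (λ i → 𝟙 (σ i == j) * next q h i)
      expected-weight j = noisy-D²-sampling e (D h) (next q h) (λ i → weight (i ∷⁺ h) j)
        0≤α 0≤ρ (0≤fromℕ 8) (0≤O j) 0≤e (λ i → 0≤weight (i ∷⁺ h) j) αD≤q q≤ραD
        (D²-sampling e (D h) (λ i → ‖ X i - c j ‖²) (λ a i → ‖ X a - X i ‖²) (λ a i → D (i ∷⁺ h) a)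
          0≤e (0≤D h) (λ i → 0≤‖‖² (X i) (c j)) (λ a i → 0≤‖‖² (X a) (X i)) (λ a i → 0≤D (i ∷⁺ h) a)
          (λ a i → φ₁-quasitriangle (X i) (X a) (centers X h))
          (λ a i → proj₁ (φ₁-∷⁺ (X a) (X i) (centers X h)))
          (λ a i → proj₂ (φ₁-∷⁺ (X a) (X i) (centers X h)))
          (pairwise e X (c j) 0≤e))
        where
        e : Fin n → Carrier
        e i = 𝟙 (σ i == j)
        0≤e : ∀ i → 0# ≤ e i
        0≤e i = 0≤𝟙 (σ i == j)

    -- The layers must be fixed before sampling for G to be a supermartingale, yet be exact for the
    -- costs at the end. Hence the final cluster costs of all continuations are collected.
    finalWeights : ℕ → History n → List Carrier
    finalWeights zero    h = List.tabulate (weight h)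
    finalWeights (suc r) h = List.concat (List.tabulate (λ i → finalWeights r (i ∷⁺ h)))

    0≤finalWeights : ∀ r h → All (0# ≤_) (finalWeights r h)
    0≤finalWeights zero    h = All.tabulate⁺ (0≤weight h)
    0≤finalWeights (suc r) h = All.concat⁺ (All.tabulate⁺ (λ i → 0≤finalWeights r (i ∷⁺ h)))

    module Induction {V : List Carrier} (cake : Layers 0# V) where

      open Potential cake
      open Round ρ 1≤ρ cost 0≤cost cake

      -- The harmonic coefficient collects the charges ρ² / s for wasted rounds over all numbers s
      -- of rounds left, from `r` down to 1.
      bound : ℕ → History n → Carrier
      bound r h = (1# + ρ * ρ * harmonic r) * budget (alive⁺ h) (weight h)
                  + (count (alive⁺ h) - fromℕ r) * G (alive⁺ h) (weight h)

      -- Backward induction over the rounds, from `terminal` through `round`. That at least `r`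
      -- clusters are unhit keeps the coefficient of G nonnegative and is itself preserved.
      𝔼-from-bound : ∀ r h → List⁺.length h ℕ.+ r ≡ k → fromℕ r ≤ count (alive⁺ h) →
        (∀ {x} → x ∈ finalWeights r h → x ∈ V) →
        𝔼-from q r h (λ h′ → φ X (centers X h′)) ≤ bound r h
      𝔼-from-bound zero h _ _ covers = begin
        sum (D h)
          ≈⟨ sum-cong {n} (λ i → *-identityˡ (D h i)) ⟨
        sum (λ i → 1# * D h i)
          ≈⟨ sum-fibres σ (λ _ → 1#) (D h) ⟩
        sum (λ j → 1# * weight h j)
          ≈⟨ sum-cong {k} (λ j → *-identityˡ (weight h j)) ⟩
        sum (weight h)
          ≤⟨ terminal (alive⁺ h) (λ j → covers (∈-tabulate⁺ j)) (0≤weight h) ⟩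
        1# * budget (alive⁺ h) (weight h) + (count (alive⁺ h) - 0#) * G (alive⁺ h) (weight h)
          ≈⟨ +-congʳ (*-congʳ (solve 1 (λ ρ → con (pos 1) := con (pos 1) :+ ρ :* ρ :* con (pos 0)) refl ρ)) ⟩
        bound 0 h ∎
      𝔼-from-bound (suc r) h length≡ r<u covers = begin
        sum (λ i → next q h i * 𝔼-from q r (i ∷⁺ h) (λ h′ → φ X (centers X h′)))
          ≤⟨ sum-mono {n} (λ i → *-monoʳ-≤ (nonNeg i) (𝔼-from-bound r (i ∷⁺ h)
               (≡.trans (≡.sym (ℕ.+-suc _ r)) length≡) (still-alive i)
               (λ x∈ → covers (∈-concat⁺′ x∈ (∈-tabulate⁺ i))))) ⟩
        sum (λ i → next q h i * bound r (i ∷⁺ h))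
          ≤⟨ round σ nonNeg sum-one (0≤D h) 0≤α αD≤q q≤ραD αΦ≤1 (alive⁺ h) (λ i → weight-∷⁺ i h) expected-weight
               r (+-nonNeg 0≤1 (*-nonNeg (*-nonNeg 0≤ρ 0≤ρ) (0≤harmonic r))) r<u ⟩
        (1# + ρ * ρ * harmonic r + ρ * ρ * (1# / fromℕ (suc r))) * budget (alive⁺ h) (weight h)
            + (count (alive⁺ h) - fromℕ (suc r)) * G (alive⁺ h) (weight h)
          ≈⟨ +-congʳ (*-congʳ (solve 3 (λ ρ a b → con (pos 1) :+ ρ :* ρ :* a :+ ρ :* ρ :* b
               := con (pos 1) :+ ρ :* ρ :* (a :+ b)) refl ρ _ _)) ⟩
        bound (suc r) h ∎
        where
        h<k : List⁺.length h ℕ.< k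
        h<k = ≡.subst (List⁺.length h ℕ.<_) length≡ (ℕ.m<m+n (List⁺.length h) (ℕ.s≤s ℕ.z≤n))

        open FromHistory h h<k

        -- A round removes at most one cluster: the slack is what was to spare before, plus one if
        -- the round was wasted.
        still-alive : ∀ i → fromℕ r ≤ count (alive⁺ (i ∷⁺ h))
        still-alive i = ≤-slack
          (+-nonNeg (x≤y⇒0≤y-x r<u) (x≤y⇒0≤y-x (𝟙≤1 (alive⁺ h (σ i)))))
          (begin-equality
            u′
              ≈⟨ solve 3 (λ u′ a r → u′ := r :+ (((u′ :+ a) :- (con (pos 1) :+ r)) :+ (con (pos 1) :- a))) refl u′ a (fromℕ r) ⟩
            fromℕ r + (((u′ + a) - fromℕ (suc r)) + (1# - a))
              ≈⟨ +-congˡ (+-congʳ (+-congʳ (count-remove (alive⁺ h) (σ i)))) ⟩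
            fromℕ r + ((count (alive⁺ h) - fromℕ (suc r)) + (1# - a)) ∎)
          where
          u′ = count (alive⁺ (i ∷⁺ h))
          a  = 𝟙 (alive⁺ h (σ i))

    -- The first round and the total expectation

    module FirstRound (0<n : 0# < fromℕ n) where

      open IsDistribution first-distribution

      α : Carrier
      α = (1# - ε) / fromℕ n

      -- Near-uniform sampling is the case of constant point costs 1. With a single center the new
      -- costs are the squared distances themselves, so `pairwise` already gives the factor 2; it is
      -- relaxed to 8 to share `cost` with the later rounds.
      expected-weight : ∀ j → sum (λ i → 𝟙 (σ i == j) * (first q i * weight [ i ] j))
                                ≤ cost j * sum (λ i → 𝟙 (σ i == j) * first q i)
      expected-weight j = noisy-D²-sampling e (λ _ → 1#) (first q) (λ i → weight [ i ] j)
        (*-nonNeg (proj₁ 0<1-ε) (proj₁ (⁻¹-pos 0<n))) 0≤ρ (0≤fromℕ 8) (0≤O j) 0≤e (λ i → 0≤weight [ i ] j)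
        (λ i → ≤-trans (≤-reflexive (*-identityʳ α)) (first-lower i))
        (λ i → ≤-trans (first-upper i) (≤-reflexive (begin-equality
          (1# + ε) * fromℕ n ⁻¹       ≈⟨ *-congʳ ρ[1-ε]≈1+ε ⟨
          ρ * (1# - ε) * fromℕ n ⁻¹   ≈⟨ solve 3 (λ ρ δ m → ρ :* δ :* m := ρ :* (δ :* m :* con (pos 1))) refl ρ (1# - ε) _ ⟩
          ρ * (α * 1#)                ∎)))
        (begin
          sum (λ i → e i * (1# * weight [ i ] j))
            ≈⟨ sum-cong {n} (λ i → *-congˡ (*-identityˡ _)) ⟩
          sum (λ i → e i * weight [ i ] j)
            ≤⟨ pairwise e X (c j) 0≤e ⟩
          fromℕ 2 * (sum e * O j)
            ≤⟨ ≤-slack (*-nonNeg (0≤fromℕ 6) (*-nonNeg (0≤sum _ 0≤e) (0≤O j)))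
                 (solve 1 (λ x → con (pos 8) :* x := con (pos 2) :* x :+ con (pos 6) :* x) refl _) ⟩
          fromℕ 8 * (sum e * O j)
            ≈⟨ *-congˡ (*-congʳ (sum-cong {n} (λ i → *-identityʳ (e i)))) ⟨
          fromℕ 8 * (sum (λ i → e i * 1#) * O j) ∎)
        where
        e : Fin n → Carrier
        e i = 𝟙 (σ i == j)
        0≤e : ∀ i → 0# ≤ e i
        0≤e i = 0≤𝟙 (σ i == j)

      initial-budget : sum (λ i → first q i * budget (alive⁺ [ i ]) (weight [ i ])) ≤ sum cost
      initial-budget = begin
        sum (λ i → first q i * budget (alive⁺ [ i ]) (weight [ i ]))
          -- Before the first sample every cluster is unhit. Current costs enter the budget only for
          -- hit clusters, so zero stands in for them and `dead-≤` is vacuous.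
          ≤⟨ budget-supermartingale σ nonNeg sum-one (λ _ → true) {λ _ → 0#} {λ i → weight [ i ]} (λ _ _ ()) expected-weight ⟩
        budget (λ _ → true) (λ _ → 0#)
          ≈⟨ +-cong (sum-0 {k} (λ _ → zeroʳ _)) (sum-cong {k} (λ j → *-identityˡ (cost j))) ⟩
        0# + sum cost
          ≈⟨ +-identityˡ _ ⟩
        sum cost ∎

      -- The first sample leaves exactly m unhit clusters and m rounds, so the G term starts with
      -- coefficient zero and only the budget remains to be averaged.
      𝔼-bound : ∀ m → k ≡ suc m →
        𝔼 q k (λ h → φ X (centers X h)) ≤ (1# + ρ * ρ * harmonic m) * (fromℕ 8 * ρ * sum (λ i → ‖ X i - c (σ i) ‖²))
      𝔼-bound m ≡.refl = begin
        sum (λ i → first q i * 𝔼-from q m [ i ] (λ h → φ X (centers X h)))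
          ≤⟨ sum-mono {n} (λ i → *-monoʳ-≤ (nonNeg i) (≤-trans
               (𝔼-from-bound m [ i ] ≡.refl (≤-reflexive (sym (uncovered≈m i)))
                 (λ x∈ → ∈-concat⁺′ x∈ (∈-tabulate⁺ i)))
               (≤-reflexive (trans (+-congˡ (trans
                 (*-congʳ (trans (+-congʳ (uncovered≈m i)) (-‿inverseʳ _))) (zeroˡ _))) (+-identityʳ _))))) ⟩
        sum (λ i → first q i * (K * budget (alive⁺ [ i ]) (weight [ i ])))
          ≈⟨ trans (sum-cong {n} (λ i → solve 3 (λ q K B → q :* (K :* B) := K :* (q :* B)) refl (first q i) K _)) (*-sum {n} K _) ⟩
        K * sum (λ i → first q i * budget (alive⁺ [ i ]) (weight [ i ]))
          ≤⟨ *-monoʳ-≤ (+-nonNeg 0≤1 (*-nonNeg (*-nonNeg 0≤ρ 0≤ρ) (0≤harmonic m))) initial-budget ⟩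
        K * sum cost
          ≈⟨ *-congˡ (trans (*-sum {k} _ O) (*-congˡ sum-O)) ⟩
        K * (fromℕ 8 * ρ * sum (λ i → ‖ X i - c (σ i) ‖²)) ∎
        where
        K = 1# + ρ * ρ * harmonic m
        V = List.concat (List.tabulate (λ i → finalWeights m [ i ]))
        open Induction (layers 0# V (All.concat⁺ (All.tabulate⁺ (λ i → 0≤finalWeights m [ i ]))))

        sum-ones : ∀ l → sum {l} (λ _ → 1#) ≈ fromℕ l
        sum-ones zero    = refl
        sum-ones (suc l) = +-congˡ (sum-ones l)

        uncovered≈m : ∀ i → count (alive⁺ [ i ]) ≈ fromℕ m
        uncovered≈m i = begin-equality
          u
            ≈⟨ solve 1 (λ u → u := (u :+ con (pos 1)) :- con (pos 1)) refl u ⟩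
          (u + 1#) - 1#
            ≈⟨ +-congʳ (count-remove (λ _ → true) (σ i)) ⟩
          sum {suc m} (λ _ → 1#) - 1#
            ≈⟨ +-congʳ (sum-ones (suc m)) ⟩
          fromℕ (suc m) - 1#
            ≈⟨ solve 1 (λ x → con (pos 1) :+ x :- con (pos 1) := x) refl (fromℕ m) ⟩
          fromℕ m ∎
          where u = count (alive⁺ [ i ])

  -- Comparison with the optimum

  module Approximation {n d : ℕ} (X : Fin n → Point d)
                       (ε : Carrier) (0≤ε : 0# ≤ ε) (ε<1 : ε < 1#) where

    open Noise ε 0≤ε ε<1

    factor : ∀ {k} → 1 ℕ.≤ k → Carrier
    factor {k} 1≤k = fromℕ 8 * (ln (fromℕ k) (1≤fromℕ 1≤k) + fromℕ 2) * ρ ^ 4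

    1≤* : ∀ {x y} → 1# ≤ x → 1# ≤ y → 1# ≤ x * y
    1≤* 1≤x 1≤y = ≤-trans (≤-reflexive (sym (*-identityˡ 1#))) (*-mono-≤ 0≤1 (≤-trans 0≤1 1≤x) 1≤x 1≤y)

    0<factor : ∀ {k} (1≤k : 1 ℕ.≤ k) → 0# < factor 1≤k
    0<factor 1≤k = <-≤-trans 0<1 (1≤* (1≤* (1≤fromℕ {8} (ℕ.s≤s ℕ.z≤n))
      (≤-trans (1≤fromℕ {2} (ℕ.s≤s ℕ.z≤n)) (≤-slack (0≤ln (1≤fromℕ 1≤k)) (+-comm _ _))))
      (1≤* 1≤ρ (1≤* 1≤ρ (1≤* 1≤ρ (1≤* 1≤ρ ≤-refl)))))

    -- Any competing set of k centers may serve as the reference: each point is assigned to a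
    -- nearest one, and the cluster costs then add up to the cost of the set.
    𝔼≤factor*cost : ∀ {k} (1≤k : 1 ℕ.≤ k) (k≤n : k ℕ.≤ n) (q : Adversary n) → NoisyRule X k ε q →
      ∀ {v} → IsCost X k v → 𝔼 q k (λ h → φ X (centers X h)) ≤ factor 1≤k * v
    𝔼≤factor*cost {suc m} 1≤k k≤n q rule {v} (C , (_ , ≡.refl) , v≈) = begin
      𝔼 q (suc m) (λ h → φ X (centers X h))
        ≤⟨ 𝔼-bound m ≡.refl ⟩
      (1# + ρ * ρ * harmonic m) * (fromℕ 8 * ρ * sum (λ i → ‖ X i - c (σ i) ‖²))
        ≤⟨ *-mono-≤ (*-nonNeg 0≤8ρ (0≤sum _ (λ i → 0≤‖‖² (X i) (c (σ i))))) (*-nonNeg 0≤ρ³ 0≤L+2)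
             constant (*-monoʳ-≤ 0≤8ρ (≤-trans (sum-mono {n} (λ i → proj₂ (φ₁-attained (X i) C))) (≤-reflexive (sym v≈)))) ⟩
      ρ * (ρ * ρ) * (L + fromℕ 2) * (fromℕ 8 * ρ * v)
        ≈⟨ solve 3 (λ ρ L v → ρ :* (ρ :* ρ) :* L :* (con (pos 8) :* ρ :* v)
             := con (pos 8) :* L :* ρ :^ 4 :* v) refl ρ (L + fromℕ 2) v ⟩
      factor 1≤k * v ∎
      where
      σ : Fin n → Fin (suc m)
      σ i = proj₁ (φ₁-attained (X i) C)

      c : Fin (suc m) → Point d
      c = List.lookup (List⁺.toList C)

      0<n : 0# < fromℕ n
      0<n = <-≤-trans 0<1 (1≤fromℕ (ℕ.≤-trans 1≤k k≤n))

      open Analysis X c σ ε 0≤ε ε<1 rule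
      open FirstRound 0<n

      L = ln (fromℕ (suc m)) (1≤fromℕ 1≤k)

      0≤ρ : 0# ≤ ρ
      0≤ρ = ≤-trans 0≤1 1≤ρ

      0≤8ρ : 0# ≤ fromℕ 8 * ρ
      0≤8ρ = *-nonNeg (0≤fromℕ 8) 0≤ρ

      0≤ρ³ : 0# ≤ ρ * (ρ * ρ)
      0≤ρ³ = *-nonNeg 0≤ρ (*-nonNeg 0≤ρ 0≤ρ)

      0≤L+2 : 0# ≤ L + fromℕ 2
      0≤L+2 = +-nonNeg (0≤ln (1≤fromℕ 1≤k)) (0≤fromℕ 2)

      -- Both 1 and ρ² are raised to ρ³; the fourth power of ρ comes from the cost of a single
      -- cluster. The 2 is this 1 plus the 1 in `harmonic≤1+ln`.
      constant : 1# + ρ * ρ * harmonic m ≤ ρ * (ρ * ρ) * (L + fromℕ 2)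
      constant = begin
        1# + ρ * ρ * harmonic m
          ≤⟨ +-mono-≤ (1≤* 1≤ρ (1≤* 1≤ρ 1≤ρ))
               (*-mono-≤ (0≤harmonic m) 0≤ρ³
                 (≤-trans (≤-reflexive (sym (*-identityˡ _))) (*-monoˡ-≤ (*-nonNeg 0≤ρ 0≤ρ) 1≤ρ))
                 (harmonic≤1+ln m (1≤fromℕ 1≤k))) ⟩
        ρ * (ρ * ρ) + ρ * (ρ * ρ) * (1# + L)
          ≈⟨ solve 2 (λ ρ L → ρ :* (ρ :* ρ) :+ ρ :* (ρ :* ρ) :* (con (pos 1) :+ L)
               := ρ :* (ρ :* ρ) :* (L :+ con (pos 2))) refl ρ L ⟩
        ρ * (ρ * ρ) * (L + fromℕ 2) ∎

    -- OPT is given as an infimum, without a minimizer. Dividing by the positive factor makes E / F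
    -- a lower bound of all costs, hence at most their infimum.
    𝔼≤factor*OPT : ∀ {k} (X-distinct : Injective _≡_ _≋_ X) (1≤k : 1 ℕ.≤ k) (k≤n : k ℕ.≤ n)
      (q : Adversary n) → NoisyRule X k ε q →
      𝔼 q k (λ h → φ X (centers X h)) ≤ factor 1≤k * OPT X X-distinct 1≤k k≤n
    𝔼≤factor*OPT {k} X-distinct 1≤k k≤n q rule = begin
      E                ≈⟨ x*y/y≈x E (0<factor 1≤k) ⟨
      E / F * F        ≈⟨ *-comm _ F ⟩
      F * (E / F)      ≤⟨ *-monoʳ-≤ (proj₁ (0<factor 1≤k)) (proj₂ (proj₂ (OPT-infimum X X-distinct 1≤k k≤n))
                            (λ {v} cost → x≤y*z⇒x/z≤y (0<factor 1≤k)
                              (≤-trans (𝔼≤factor*cost 1≤k k≤n q rule cost) (≤-reflexive (*-comm F v))))) ⟩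
      F * OPT X X-distinct 1≤k k≤n ∎
      where
      E = 𝔼 q k (λ h → φ X (centers X h))
      F = factor 1≤k

theorem1p1 : (ℝ : CompleteOrderedField) →
    let open KMeans ℝ in
    (d n k : ℕ) (X : Fin n → Point d) (X-distinct : Injective _≡_ _≋_ X)
    (1≤k : 1 ℕ.≤ k) (k≤n : k ℕ.≤ n) →
    (ε : Carrier) → 0# ≤ ε → ε < 1# →
    ((q : Adversary n) → NoisyRule X k ε q →
    𝔼 q k (λ h → φ X (centers X h))
    ≤ fromℕ 8 * (ln (fromℕ k) (1≤fromℕ 1≤k) + fromℕ 2)
    * ((1# + ε) / (1# - ε)) ^ 4
    * OPT X X-distinct 1≤k k≤n)
    × (ε < 1# / fromℕ 2 →
    ((1# + ε) / (1# - ε)) ^ 4 ≤ 1# + fromℕ 160 * ε)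
theorem1p1 ℝ d n k X X-distinct 1≤k k≤n ε 0≤ε ε<1 =
  Development.Approximation.𝔼≤factor*OPT ℝ X ε 0≤ε ε<1 X-distinct 1≤k k≤n , Development.Noise.ρ⁴≤1+160ε ℝ ε 0≤ε ε<1
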